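{- Let $(\mathcal{H},\mathcal{M})$ be a matroid-rooted mixed hypergraph with $\mathcal{H}=(V\cup R,\mathcal{A}\cup\mathcal{E})$ and $\mathcal{M}=(R,r_{\mathcal{M}})$. Then there exists a matroid-based packing of mixed hyperarborescences in $(\mathcal{H},\mathcal{M})$ if and only if for every biset subpartition $\{\mathsf{X}^i\}_{i=1}^{\ell}$ of $V$ with $X_W^i=N_{\mathcal{H}}^-(X_I^i)\cap R$ for $i=1,\dots,\ell$, $$e_{\mathcal{E}}(\{X_I^i\}_{1}^{\ell})+\sum_{i=1}^{\ell} d^-_{\mathcal{A}}(\mathsf{X}^i)\geq \sum_{i=1}^{\ell}\bigl(r_{\mathcal{M}}(R)-r_{\mathcal{M}}(X_W^i)\bigr).$$
   Context: A mixed hypergraph $\mathcal{H}=(W,\mathcal{A}\cup\mathcal{E})$ has a finite vertex set $W$, a finite (multi)set $\mathcal{A}$ of dyperedges and a finite (multi)set $\mathcal{E}$ of hyperedges. A dyperedge $a$ is a pair $(tail(a),head(a))$ with $head(a)\in W$ and $\emptyset\neq tail(a)\subseteq W-head(a)$; a hyperedge is a subset of $W$ of size at least $2$. For $X\subseteq W$: a dyperedge $a$ enters $X$ if $head(a)\in X$ and $tail(a)-X\neq\emptyset$, and leaves $X$ if it enters $W-X$; a hyperedge enters $X$ if it meets both $X$ and $W-X$; $N^-_{\mathcal{H}}(X)$ is the union of $tail(a)-X$ over all dyperedges $a$ entering $X$. A vertex $r$ is a root if no dyperedge and no hyperedge enters $\{r\}$ and every dyperedge leaving $\{r\}$ has tail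 exactly $\{r\}$. A matroid-rooted mixed hypergraph is a pair $(\mathcal{H},\mathcal{M})$ where $\mathcal{H}=(V\cup R,\mathcal{A}\cup\mathcal{E})$ with $V\cap R=\emptyset$, every vertex of $R$ is a root, and $\mathcal{M}$ is a matroid on $R$ with rank function $r_{\mathcal{M}}$. Trimming a dyperedge $a$ means replacing it by an arc $uv$ with $v=head(a)$, $u\in tail(a)$; trimming a hyperedge $e$ means replacing it by an arc $uv$ with $u\neq v\in e$. An $r$-arborescence is a digraph whose underlying graph is a tree, in which $r$ has in-degree $0$ and every other vertex has in-degree $1$ (possibly just $r$). A mixed $r$-hyperarborescence is a sub-mixed-hypergraph whose dyperedges and hyperedges can be trimmed to give an $r$-arborescence. A matroid-based packing of mixed hyperarborescences is a family $\{\mathcal{B}_r\}_{r\in R}$ of mixed hyperarborescences in $\mathcal{H}$, pairwise sharing no dyperedge and no hyperedge, such that each $\mathcal{B}_r$ can be trimmed to an $r$-arborescence $B_r$ so that for every $v\in V$ the set $\{r\in R:v\in V(B_r)\}$ is a basis of $\mathcal{M}$ (independent of size $r_{\mathcal{M}}(R)$). A biset is $\mathsf{X}=(X_O,X_I)$ with $X_I\subseteq X_O\subseteq V\cup R$; its wall is $X_W=X_O-X_I$. A dyperedge $a$ enters $\mathsf{X}$ if $head(a)\in X_I$ and $tail(a)-X_O\neq\emptyset$; $d^-_{\mathcal{A}}(\mathsf{X})$ is the number of such dyperedges. For $C\subseteq V\cup R$, a biset subpartition of $C$ is a family $\{\mathsf{X}^i\}_{i=1}^{\ell}$ of bisets with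 the $X_I^i$ nonempty, pairwise disjoint subsets of $C$ and $X_W^i\subseteq (V\cup R)-C$ for all $i$. $e_{\mathcal{E}}(\{X_I^i\}_1^\ell)$ is the number of hyperedges entering at least one $X_I^i$. -}

module Defs where

open import Data.Nat using (ℕ; zero; suc; _+_; _∸_; _≤_; _≥_; _<ᵇ_)
open import Data.Bool using (Bool; true; false; _∧_; _∨_; not; T)
open import Data.Fin using (Fin; _≟_; splitAt)
open import Data.Fin.Subset using (Subset; _∈_; _∉_; _⊆_; ⁅_⁆; ∁; _∩_; _∪_; _─_; ∣_∣; Nonempty; Empty)
open import Data.Vec using (Vec; lookup; tabulate; sum)
open import Data.Maybe using (Maybe; just; nothing)
open import Data.Sum using (_⊎_; [_,_])
open import Data.Product using (_×_; Σ; _,_)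
open import Relation.Binary.PropositionalEquality using (_≡_; _≢_)
open import Relation.Nullary.Decidable using (⌊_⌋)

_∈ᵇ_ : ∀ {n} → Fin n → Subset n → Bool
v ∈ᵇ X = lookup X v

_==_ : ∀ {n} → Fin n → Fin n → Bool
u == v = ⌊ u ≟ v ⌋

cnt : ∀ {m} → (Fin m → Bool) → ℕ
cnt p = ∣ tabulate p ∣

anyᵇ : ∀ {m} → (Fin m → Bool) → Bool
anyᵇ p = 0 <ᵇ cnt p

nonemptyᵇ : ∀ {n} → Subset n → Bool
nonemptyᵇ X = 0 <ᵇ ∣ X ∣

Σ[_] : ∀ {ℓ} → (Fin ℓ → ℕ) → ℕ
Σ[ f ] = sum (tabulate f)

-- Mixed hypergraphs on the vertex set W = Fin n.
-- Dyperedges are indexed by Fin na, hyperedges by Fin nh (multisets).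

record MixedHypergraph (n : ℕ) : Set where
  field
    na : ℕ
    tail : Fin na → Subset n
    head : Fin na → Fin n
    tail-nonempty : ∀ a → Nonempty (tail a)
    head∉tail : ∀ a → head a ∉ tail a
    nh : ℕ
    hedge : Fin nh → Subset n
    hedge-size : ∀ e → 2 ≤ ∣ hedge e ∣

module _ {n : ℕ} (H : MixedHypergraph n) where
  open MixedHypergraph H

  entersBᵇ : Fin na → Subset n → Subset n → Bool
  entersBᵇ a XO XI = (head a ∈ᵇ XI) ∧ nonemptyᵇ (tail a ─ XO)

  entersAᵇ : Fin na → Subset n → Bool
  entersAᵇ a X = entersBᵇ a X X

  leavesAᵇ : Fin na → Subset n → Bool
  leavesAᵇ a X = entersAᵇ a (∁ X)

  entersEᵇ : Fin nh → Subset n → Bool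
  entersEᵇ e X = nonemptyᵇ (hedge e ∩ X) ∧ nonemptyᵇ (hedge e ∩ ∁ X)

  N⁻ : Subset n → Subset n
  N⁻ X = tabulate λ v → anyᵇ λ a → entersAᵇ a X ∧ (v ∈ᵇ tail a) ∧ not (v ∈ᵇ X)

  d⁻ : Subset n → Subset n → ℕ
  d⁻ XO XI = cnt λ a → entersBᵇ a XO XI

  eE : ∀ {ℓ} → (Fin ℓ → Subset n) → ℕ
  eE XI = cnt λ e → anyᵇ λ i → entersEᵇ e (XI i)

  IsRoot : Fin n → Set
  IsRoot r =
    (∀ a → T (entersAᵇ a ⁅ r ⁆) → Data.Empty.⊥) ×
    (∀ e → T (entersEᵇ e ⁅ r ⁆) → Data.Empty.⊥) ×
    (∀ a → T (leavesAᵇ a ⁅ r ⁆) → tail a ≡ ⁅ r ⁆)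
    where import Data.Empty

-- Matroids on a ground set R ⊆ Fin n, given by their rank function
-- (rank axioms required on subsets of R; values outside are irrelevant).

record Matroid {n : ℕ} (R : Subset n) : Set where
  field
    rank : Subset n → ℕ
    rank-bound : ∀ X → X ⊆ R → rank X ≤ ∣ X ∣
    rank-mono : ∀ X Y → X ⊆ Y → Y ⊆ R → rank X ≤ rank Y
    rank-submod : ∀ X Y → X ⊆ R → Y ⊆ R →
                  rank (X ∪ Y) + rank (X ∩ Y) ≤ rank X + rank Y

module _ {n : ℕ} {R : Subset n} (M : Matroid R) where
  open Matroid M

  Independent : Subset n → Set
  Independent X = X ⊆ R × rank X ≡ ∣ X ∣

  IsBasis : Subset n → Set
  IsBasis B = Independent B × ∣ B ∣ ≡ rank R

-- Digraphs on Fin n with arcs indexed by Fin m (arc i goes src i → tgt i);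
-- a sub-digraph is selected by sel : Fin m → Bool.

module _ {n m : ℕ} (src tgt : Fin m → Fin n) (sel : Fin m → Bool) (r : Fin n) where

  VS : Subset n
  VS = tabulate λ v → (v == r) ∨ anyᵇ (λ i → sel i ∧ ((src i == v) ∨ (tgt i == v)))

  narcs : ℕ
  narcs = cnt sel

  indeg : Fin n → ℕ
  indeg v = cnt λ i → sel i ∧ (tgt i == v)

  data Reach : Fin n → Set where
    here : Reach r
    step : ∀ {u w} (i : Fin m) → T (sel i) →
           ((src i ≡ u × tgt i ≡ w) ⊎ (tgt i ≡ u × src i ≡ w)) →
           Reach u → Reach w

  IsTree : Set
  IsTree = (∀ v → v ∈ VS → Reach v) × (narcs + 1 ≡ ∣ VS ∣)

  IsArborescence : Set
  IsArborescence = IsTree × indeg r ≡ 0 × (∀ v → v ∈ VS → v ≢ r → indeg v ≡ 1)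

-- Matroid-based packing of mixed hyperarborescences.
-- Each dyperedge / hyperedge is owned by at most one root (so the
-- hyperarborescences are pairwise edge-disjoint); each is trimmed to an arc.

module _ {n : ℕ} (H : MixedHypergraph n) (R : Subset n) (M : Matroid R) where
  open MixedHypergraph H

  record Trimming : Set where
    field
      ownA : Fin na → Maybe (Fin n)
      ownE : Fin nh → Maybe (Fin n)
      ownA-root : ∀ a r → ownA a ≡ just r → r ∈ R
      ownE-root : ∀ e r → ownE e ≡ just r → r ∈ R
      -- trimming of dyperedges: a ↦ tl a → head a with tl a ∈ tail a
      tl : Fin na → Fin n
      tl∈ : ∀ a → tl a ∈ tail a
      -- trimming of hyperedges: e ↦ hu e → hv e with hu e ≠ hv e ∈ e
      hu hv : Fin nh → Fin n
      hu∈ : ∀ e → hu e ∈ hedge e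
      hv∈ : ∀ e → hv e ∈ hedge e
      hu≢hv : ∀ e → hu e ≢ hv e

  module _ (t : Trimming) where
    open Trimming t

    src : Fin (na + nh) → Fin n
    src i = [ tl , hu ] (splitAt na i)

    tgt : Fin (na + nh) → Fin n
    tgt i = [ head , hv ] (splitAt na i)

    owner : Fin (na + nh) → Maybe (Fin n)
    owner i = [ ownA , ownE ] (splitAt na i)

    isOwn : Fin n → Maybe (Fin n) → Bool
    isOwn r (just s) = s == r
    isOwn r nothing = false

    selR : Fin n → Fin (na + nh) → Bool
    selR r i = isOwn r (owner i)

    VB : Fin n → Subset n
    VB r = VS src tgt (selR r) r

  record Packing : Set where
    field
      trim : Trimming
      arb : ∀ r → r ∈ R → IsArborescence (src trim) (tgt trim) (selR trim r) r
      basis : ∀ v → v ∉ R → IsBasis M (tabulate λ r → (r ∈ᵇ R) ∧ (v ∈ᵇ VB trim r))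

  open Matroid M

  Condition : Set
  Condition =
    ∀ (ℓ : ℕ) (XO XI : Fin ℓ → Subset n) →
    (∀ i → XI i ⊆ XO i) →
    (∀ i → Nonempty (XI i)) →
    (∀ i → XI i ⊆ ∁ R) →
    (∀ i j → i ≢ j → Empty (XI i ∩ XI j)) →
    (∀ i → (XO i ─ XI i) ⊆ R) →   -- wall ⊆ (V ∪ R) − V = R
    (∀ i → (XO i ─ XI i) ≡ N⁻ H (XI i) ∩ R) →
    eE H XI + Σ[ (λ i → d⁻ H (XO i) (XI i)) ] ≥ Σ[ (λ i → rank R ∸ rank (XO i ─ XI i)) ]

-- Necessity: for v ∈ X_I and a root r in the basis at v but outside the wall, the path from r to v in B_r uses an
-- edge that enters X with its head in X_I. These edges are distinct for distinct r, there are at least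
-- r(R) − r(X_W) of them, and a hyperedge has one head, so it is counted for at most one X_I.
--
-- Sufficiency: uncrossing violated families of disjoint sets shows that the hyperedges can be given heads one at a
-- time, so that the condition survives with each hyperedge e replaced by a dyperedge from e − hv e to hv e.
-- Then each r ∈ R starts as the trivial arborescence. Root dyperedges are assigned greedily, until the set P v of
-- roots whose arborescence contains v spans every root with a dyperedge into v; from then on every nonempty X ⊆ V
-- satisfies d(X) + r(P(X)) ≥ r(R), where d counts the unassigned edges that enter X. As long as some P v is not
-- spanning, V is tight. A tight X with r(P v) < r(P(X)) for some v ∈ X contains an edge whose tail has a root r
-- that its head does not span: otherwise Z = {w ∈ X : P w ⊆ span P v} would violate the inequality. If assigning
-- that edge to r violates it at a set Y, then Y is tight and X ∩ Y is a smaller tight set of the same kind, so a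
-- minimal such X yields an assignment that preserves the inequality.

module Submission where

open import Defs
open import Data.Bool using (Bool; true; false; _∧_; _∨_; not; T)
open import Data.Bool.Properties using (T-∧; T-∨; T?)
open import Data.Empty using (⊥-elim)
open import Data.Fin using (Fin; zero; suc; _≟_; splitAt; _↑ˡ_; _↑ʳ_)
open import Data.Fin.Properties using (any?; suc-injective; splitAt-↑ˡ; splitAt-↑ʳ; splitAt⁻¹-↑ˡ; splitAt⁻¹-↑ʳ)
open import Data.Fin.Subset using (Subset; _∈_; _∉_; _⊆_; ⊥; ⁅_⁆; ∁; _∩_; _∪_; _─_; _-_; ∣_∣; Nonempty; Empty)
open import Data.Fin.Subset.Properties using
  ( _∈?_; nonempty?; anySubset?; _⊆?_; ⊆-antisym; ⊆-trans; p⊆q⇒∣p∣≤∣q∣; p⊂q⇒∣p∣<∣q∣; ∉⊥; ∣⊥∣≡0; Empty-unique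
  ; x∈⁅x⁆; x∈⁅y⁆⇒x≡y; ∣⁅x⁆∣≡1; x∈p∩q⁺; x∈p∩q⁻; x∈p∪q⁺; x∈p∪q⁻; p⊆p∪q; q⊆p∪q; p∩q⊆p; p∩q⊆q
  ; x∈p∧x∉q⇒x∈p─q; p─q⊆p; x∈p∧x≢y⇒x∈p-y; x∈p⇒∣p-x∣<∣p∣; x∈∁p⇒x∉p; x∉p⇒x∈∁p; ∣p∣≤n
  ; ∪-identityˡ; ∪-identityʳ; ∪-assoc; ∩-zeroˡ; ∩-zeroʳ; ∩-distribʳ-∪ )
open import Data.Maybe using (Maybe; just; nothing)
open import Data.Maybe.Properties using (just-injective)
open import Data.Nat using (ℕ; zero; suc; _+_; _*_; _∸_; _≤_; _<_; z≤n; s≤s; z<s; _≤?_; _<?_)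
open import Data.Nat.Properties hiding (_≟_; suc-injective)
open import Data.Nat.Tactic.RingSolver using (solve-∀)
open import Data.Product using (_×_; _,_; proj₁; proj₂; Σ; ∃)
open import Data.Sum using (_⊎_; inj₁; inj₂; [_,_])
open import Data.Unit using (tt)
open import Data.Vec using (_∷_; lookup; tabulate)
open import Data.Vec.Properties using (lookup∘tabulate; tabulate-cong; []=⇒lookup; lookup⇒[]=)
open import Function using (_∘_; id)
open import Function.Bundles using (_⇔_; mk⇔; module Equivalence)
open import Relation.Binary.PropositionalEquality using (_≡_; _≢_; refl; sym; trans; cong; cong₂; subst; subst₂)
open import Relation.Nullary using (¬_; Dec; yes; no)
open import Relation.Nullary.Decidable using (⌊_⌋; toWitness; fromWitness; decidable-stable; _×-dec_; ¬?)

private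
  variable
    n m : ℕ

-- Boolean tests and subsets of finite sets.

∈⇒T : {x : Fin n} {X : Subset n} → x ∈ X → T (x ∈ᵇ X)
∈⇒T {x = x} {X} x∈X = subst T (sym ([]=⇒lookup x∈X)) tt

T⇒∈ : {x : Fin n} {X : Subset n} → T (x ∈ᵇ X) → x ∈ X
T⇒∈ {x = x} {X} t with lookup X x in eq
... | true = lookup⇒[]= x X eq

∈tabulate⁺ : {p : Fin n → Bool} {x : Fin n} → T (p x) → x ∈ tabulate p
∈tabulate⁺ {p = p} {x} t = T⇒∈ (subst T (sym (lookup∘tabulate p x)) t)

∈tabulate⁻ : {p : Fin n → Bool} {x : Fin n} → x ∈ tabulate p → T (p x)
∈tabulate⁻ {p = p} {x} x∈ = subst T (lookup∘tabulate p x) (∈⇒T x∈)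

T-nonempty⁺ : {X : Subset n} → Nonempty X → T (nonemptyᵇ X)
T-nonempty⁺ {X = true  ∷ X} _ = tt
T-nonempty⁺ {X = false ∷ X} (suc x , Data.Vec.there x∈X) = T-nonempty⁺ (x , x∈X)

T-nonempty⁻ : {X : Subset n} → T (nonemptyᵇ X) → Nonempty X
T-nonempty⁻ {X = true  ∷ X} _ = zero , Data.Vec.here
T-nonempty⁻ {X = false ∷ X} t with x , x∈X ← T-nonempty⁻ {X = X} t = suc x , Data.Vec.there x∈X

T-any⁺ : {p : Fin m → Bool} (i : Fin m) → T (p i) → T (anyᵇ p)
T-any⁺ i t = T-nonempty⁺ (i , ∈tabulate⁺ t)

T-any⁻ : {p : Fin m → Bool} → T (anyᵇ p) → ∃ λ i → T (p i)
T-any⁻ {p = p} t with i , i∈ ← T-nonempty⁻ {X = tabulate p} t = i , ∈tabulate⁻ i∈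

T-==⁺ : {u v : Fin n} → u ≡ v → T (u == v)
T-==⁺ = fromWitness

T-==⁻ : {u v : Fin n} → T (u == v) → u ≡ v
T-==⁻ = toWitness

T-∧⁺ : {a b : Bool} → T a → T b → T (a ∧ b)
T-∧⁺ ta tb = Equivalence.from T-∧ (ta , tb)

T-∧⁻ : {a b : Bool} → T (a ∧ b) → T a × T b
T-∧⁻ = Equivalence.to T-∧

T-∨⁺ : {a b : Bool} → T a ⊎ T b → T (a ∨ b)
T-∨⁺ = Equivalence.from T-∨

T-∨⁻ : {a b : Bool} → T (a ∨ b) → T a ⊎ T b
T-∨⁻ = Equivalence.to T-∨

T-not⁺ : {a : Bool} → ¬ T a → T (not a)
T-not⁺ {false} _ = tt
T-not⁺ {true}  f = f tt

T-ext : {a b : Bool} → (T a → T b) → (T b → T a) → a ≡ b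
T-ext {false} {false} _ _ = refl
T-ext {false} {true}  _ g = ⊥-elim (g tt)
T-ext {true}  {false} f _ = ⊥-elim (f tt)
T-ext {true}  {true}  _ _ = refl

∈─⁻ : {x : Fin n} {X Y : Subset n} → x ∈ X ─ Y → x ∈ X × x ∉ Y
∈─⁻ {x = zero}  {true ∷ X} {false ∷ Y} Data.Vec.here = Data.Vec.here , λ ()
∈─⁻ {x = suc x} {a ∷ X} {b ∷ Y} (Data.Vec.there x∈) with ∈X , ∉Y ← ∈─⁻ {X = X} {Y} x∈ =
  Data.Vec.there ∈X , λ { (Data.Vec.there ∈Y) → ∉Y ∈Y }

⊈⇒∃ : {X Y : Subset n} → ¬ (X ⊆ Y) → ∃ λ x → x ∈ X × x ∉ Y
⊈⇒∃ {X = X} {Y} X⊈Y with nonempty? (X ─ Y)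
... | yes (x , x∈) = x , ∈─⁻ x∈
... | no empty = ⊥-elim (X⊈Y sub)
  where
  sub : X ⊆ Y
  sub {x} x∈X with x ∈? Y
  ... | yes x∈Y = x∈Y
  ... | no x∉Y = ⊥-elim (empty (x , x∈p∧x∉q⇒x∈p─q x∈X x∉Y))

∪-⊆ : {X Y Z : Subset n} → X ⊆ Z → Y ⊆ Z → X ∪ Y ⊆ Z
∪-⊆ {X = X} {Y} X⊆Z Y⊆Z x∈ = [ X⊆Z , Y⊆Z ] (x∈p∪q⁻ X Y x∈)

∪-mono : {X X′ Y Y′ : Subset n} → X ⊆ X′ → Y ⊆ Y′ → X ∪ Y ⊆ X′ ∪ Y′
∪-mono X⊆ Y⊆ = ∪-⊆ (λ x∈ → x∈p∪q⁺ (inj₁ (X⊆ x∈))) (λ x∈ → x∈p∪q⁺ (inj₂ (Y⊆ x∈)))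

⁅⁆⊆ : {x : Fin n} {X : Subset n} → x ∈ X → ⁅ x ⁆ ⊆ X
⁅⁆⊆ {x = x} {X} x∈X y∈ = subst (_∈ X) (sym (x∈⁅y⁆⇒x≡y x y∈)) x∈X

card-mono : (X Y : Subset n) → X ⊆ Y → ∣ X ∣ ≤ ∣ Y ∣
card-mono X Y = p⊆q⇒∣p∣≤∣q∣ {p = X} {Y}

∣∪⁅⁆∣ : (x : Fin n) (X : Subset n) → x ∉ X → ∣ X ∪ ⁅ x ⁆ ∣ ≡ suc ∣ X ∣
∣∪⁅⁆∣ zero    (true ∷ X)  x∉X = ⊥-elim (x∉X Data.Vec.here)
∣∪⁅⁆∣ zero    (false ∷ X) x∉X = cong (λ Y → suc ∣ Y ∣) (∪-identityʳ X)
∣∪⁅⁆∣ (suc x) (true ∷ X)  x∉X = cong suc (∣∪⁅⁆∣ x X (λ x∈ → x∉X (Data.Vec.there x∈)))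
∣∪⁅⁆∣ (suc x) (false ∷ X) x∉X = ∣∪⁅⁆∣ x X (λ x∈ → x∉X (Data.Vec.there x∈))

∣X∣≤1+∣X-x∣ : (X : Subset n) (x : Fin n) → ∣ X ∣ ≤ suc ∣ X - x ∣
∣X∣≤1+∣X-x∣ X x = ≤-trans (card-mono X ((X - x) ∪ ⁅ x ⁆) sub) (≤-reflexive (∣∪⁅⁆∣ x (X - x) (λ x∈ → proj₂ (∈─⁻ {X = X} {⁅ x ⁆} x∈) (x∈⁅x⁆ x))))
  where
  sub : X ⊆ (X - x) ∪ ⁅ x ⁆
  sub {y} y∈X with y ≟ x
  ... | yes refl = x∈p∪q⁺ (inj₂ (x∈⁅x⁆ x))
  ... | no y≢x = x∈p∪q⁺ (inj₁ (x∈p∧x≢y⇒x∈p-y y∈X y≢x))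

-- Indicators, finite sums and counting.

bit : Bool → ℕ
bit true  = 1
bit false = 0

bit≤1 : ∀ b → bit b ≤ 1
bit≤1 true  = s≤s z≤n
bit≤1 false = z≤n

T⇒bit≡1 : {a : Bool} → T a → bit a ≡ 1
T⇒bit≡1 {true} _ = refl

¬T⇒bit≡0 : {a : Bool} → ¬ T a → bit a ≡ 0
¬T⇒bit≡0 {false} _ = refl
¬T⇒bit≡0 {true}  f = ⊥-elim (f tt)

-- The contribution of a single edge to a submodular inequality between counting functions;
-- `cnt-+≤+` sums these contributions.
bit-submod : {a b c d : Bool} → (T a → T c ⊎ T d) → (T b → T c ⊎ T d) → (T a → T b → T c × T d) →
             bit a + bit b ≤ bit c + bit d
bit-submod {false} {false} _ _ _ = z≤n
bit-submod {true}  {true}  _ _ h with tc , td ← h tt tt =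
  ≤-reflexive (sym (cong₂ _+_ (T⇒bit≡1 tc) (T⇒bit≡1 td)))
bit-submod {true}  {false} {c} {d} f _ _ with f tt
... | inj₁ tc = ≤-trans (≤-reflexive (sym (T⇒bit≡1 tc))) (m≤m+n (bit c) (bit d))
... | inj₂ td = ≤-trans (≤-reflexive (sym (T⇒bit≡1 td))) (m≤n+m (bit d) (bit c))
bit-submod {false} {true}  {c} {d} _ f _ with f tt
... | inj₁ tc = ≤-trans (≤-reflexive (sym (T⇒bit≡1 tc))) (m≤m+n (bit c) (bit d))
... | inj₂ td = ≤-trans (≤-reflexive (sym (T⇒bit≡1 td))) (m≤n+m (bit d) (bit c))

+-interchange : ∀ a b c d → (a + b) + (c + d) ≡ (a + c) + (b + d)
+-interchange = solve-∀

Σ-mono : {f g : Fin m → ℕ} → (∀ i → f i ≤ g i) → Σ[ f ] ≤ Σ[ g ]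
Σ-mono {zero}  f≤g = z≤n
Σ-mono {suc m} f≤g = +-mono-≤ (f≤g zero) (Σ-mono (f≤g ∘ suc))

Σ-+ : (f g : Fin m → ℕ) → Σ[ f ] + Σ[ g ] ≡ Σ[ (λ i → f i + g i) ]
Σ-+ {zero}  f g = refl
Σ-+ {suc m} f g = trans (+-interchange (f zero) _ (g zero) _) (cong (f zero + g zero +_) (Σ-+ (f ∘ suc) (g ∘ suc)))

Σ-const : ∀ m c → Σ[ (λ (_ : Fin m) → c) ] ≡ m * c
Σ-const zero    c = refl
Σ-const (suc m) c = cong (c +_) (Σ-const m c)

cnt-suc : (p : Fin (suc m) → Bool) → cnt p ≡ bit (p zero) + cnt (p ∘ suc)
cnt-suc p with p zero
... | true  = refl
... | false = refl

cnt≡Σ : (p : Fin m → Bool) → cnt p ≡ Σ[ bit ∘ p ]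
cnt≡Σ {zero}  p = refl
cnt≡Σ {suc m} p = trans (cnt-suc p) (cong (bit (p zero) +_) (cnt≡Σ (p ∘ suc)))

cnt-cong : {p q : Fin m → Bool} → (∀ i → p i ≡ q i) → cnt p ≡ cnt q
cnt-cong p≗q = cong ∣_∣ (tabulate-cong p≗q)

cnt-mono : {p q : Fin m → Bool} → (∀ i → T (p i) → T (q i)) → cnt p ≤ cnt q
cnt-mono {p = p} {q} p⇒q = card-mono (tabulate p) (tabulate q) λ x∈ → ∈tabulate⁺ (p⇒q _ (∈tabulate⁻ x∈))

cnt-≤+ : {p q r : Fin m → Bool} → (∀ i → bit (p i) ≤ bit (q i) + bit (r i)) → cnt p ≤ cnt q + cnt r
cnt-≤+ {p = p} {q} {r} h = subst₂ _≤_ (sym (cnt≡Σ p)) (trans (sym (Σ-+ (bit ∘ q) (bit ∘ r))) (sym (cong₂ _+_ (cnt≡Σ q) (cnt≡Σ r)))) (Σ-mono h)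

cnt-+≤+ : {p q r s : Fin m → Bool} → (∀ i → bit (p i) + bit (q i) ≤ bit (r i) + bit (s i)) →
          cnt p + cnt q ≤ cnt r + cnt s
cnt-+≤+ {p = p} {q} {r} {s} h = subst₂ _≤_ (eq p q) (eq r s) (Σ-mono h)
  where
  eq : ∀ a b → Σ[ (λ i → bit (a i) + bit (b i)) ] ≡ cnt a + cnt b
  eq a b = trans (sym (Σ-+ (bit ∘ a) (bit ∘ b))) (sym (cong₂ _+_ (cnt≡Σ a) (cnt≡Σ b)))

cnt≡0 : {p : Fin m → Bool} → (∀ i → ¬ T (p i)) → cnt p ≡ 0
cnt≡0 {m = m} {p = p} h = n≤0⇒n≡0 (subst (cnt p ≤_) (∣⊥∣≡0 m) (card-mono (tabulate p) ⊥ λ x∈ → ⊥-elim (h _ (∈tabulate⁻ x∈))))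

cnt-<⇒∃ : (p q : Fin m → Bool) → cnt p < cnt q → ∃ λ i → T (q i) × ¬ T (p i)
cnt-<⇒∃ p q p<q with ⊈⇒∃ {X = tabulate q} {tabulate p} (λ q⊆p → <⇒≱ p<q (card-mono _ _ q⊆p))
... | i , i∈ , i∉ = i , ∈tabulate⁻ i∈ , λ t → i∉ (∈tabulate⁺ t)

cnt≡0⇒¬T : {p : Fin m → Bool} → cnt p ≡ 0 → ∀ i → ¬ T (p i)
cnt≡0⇒¬T {p = p} eq i t = subst T (cong (0 Data.Nat.<ᵇ_) eq) (T-any⁺ {p = p} i t)

cnt≡1⇒unique : (p : Fin m → Bool) → cnt p ≡ 1 → ∀ {i j} → T (p i) → T (p j) → i ≡ j
cnt≡1⇒unique p eq {i} {j} ti tj with i ≟ j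
... | yes i≡j = i≡j
... | no i≢j = ⊥-elim (<-irrefl (sym eq) (<-≤-trans (s≤s (<-≤-trans z<s (≤-trans (≤-reflexive (sym (∣⁅x⁆∣≡1 j))) (card-mono ⁅ j ⁆ (tabulate p - i) (⁅⁆⊆ j∈)))))
                  (x∈p⇒∣p-x∣<∣p∣ {x = i} {p = tabulate p} (∈tabulate⁺ ti))))
  where
  j∈ : j ∈ tabulate p - i
  j∈ = x∈p∧x≢y⇒x∈p-y (∈tabulate⁺ tj) (i≢j ∘ sym)

cnt-add : (p q : Fin m → Bool) (i : Fin m) → ¬ T (p i) → T (q i) → (∀ j → j ≢ i → q j ≡ p j) → cnt q ≡ suc (cnt p)
cnt-add p q i ¬pi qi same = trans (cong ∣_∣ (⊆-antisym to from)) (∣∪⁅⁆∣ i (tabulate p) (¬pi ∘ ∈tabulate⁻))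
  where
  to : tabulate q ⊆ tabulate p ∪ ⁅ i ⁆
  to {j} j∈ with j ≟ i
  ... | yes refl = x∈p∪q⁺ (inj₂ (x∈⁅x⁆ i))
  ... | no j≢i = x∈p∪q⁺ (inj₁ (∈tabulate⁺ (subst T (same j j≢i) (∈tabulate⁻ j∈))))
  from : tabulate p ∪ ⁅ i ⁆ ⊆ tabulate q
  from {j} j∈ with j ≟ i
  ... | yes refl = ∈tabulate⁺ qi
  ... | no j≢i with x∈p∪q⁻ (tabulate p) ⁅ i ⁆ j∈
  ...   | inj₁ j∈p = ∈tabulate⁺ (subst T (sym (same j j≢i)) (∈tabulate⁻ j∈p))
  ...   | inj₂ j∈i = ⊥-elim (j≢i (x∈⁅y⁆⇒x≡y i j∈i))

-- `own` is a function, so indices chosen for different elements of `S` are different.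
card≤cnt : (S : Subset n) (p : Fin m → Bool) (own : Fin m → Maybe (Fin n)) →
           (∀ r → r ∈ S → ∃ λ j → T (p j) × own j ≡ just r) → ∣ S ∣ ≤ cnt p
card≤cnt {n = n} {m = zero} S p own h =
  ≤-reflexive (trans (cong ∣_∣ (Empty-unique {p = S} λ { (r , r∈) → no-index (proj₁ (h r r∈)) })) (∣⊥∣≡0 n))
  where
  no-index : ¬ Fin 0
  no-index ()
card≤cnt {m = suc m} S p own h with p zero in p0 | own zero in own0
... | false | _ = card≤cnt S (p ∘ suc) (own ∘ suc) λ r r∈ → shift r (h r r∈)
  where
  shift : ∀ r → (∃ λ j → T (p j) × own j ≡ just r) → ∃ λ j → T (p (suc j)) × own (suc j) ≡ just r
  shift r (zero  , t , _) = ⊥-elim (subst T p0 t)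
  shift r (suc j , t , e) = j , t , e
... | true | nothing = m≤n⇒m≤1+n (card≤cnt S (p ∘ suc) (own ∘ suc) λ r r∈ → shift r (h r r∈))
  where
  shift : ∀ r → (∃ λ j → T (p j) × own j ≡ just r) → ∃ λ j → T (p (suc j)) × own (suc j) ≡ just r
  shift r (zero  , _ , e) with () ← trans (sym own0) e
  shift r (suc j , t , e) = j , t , e
-- Index `zero` can serve only its owner `s`; removing `s` from `S` pays for the one unit that it
-- contributes to the count.
... | true | just s = ≤-trans (∣X∣≤1+∣X-x∣ S s)
    (s≤s (card≤cnt (S - s) (p ∘ suc) (own ∘ suc) λ r r∈ →
      let r∈S , r∉s = ∈─⁻ {X = S} r∈ in shift r (λ { refl → r∉s (x∈⁅x⁆ s) }) (h r r∈S)))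
  where
  shift : ∀ r → r ≢ s → (∃ λ j → T (p j) × own j ≡ just r) → ∃ λ j → T (p (suc j)) × own (suc j) ≡ just r
  shift r r≢s (zero  , _ , e) = ⊥-elim (r≢s (just-injective (trans (sym e) own0)))
  shift r r≢s (suc j , t , e) = j , t , e

-- Unions of a family of sets over a set of vertices.

module Families {n : ℕ} where

  image : (Fin n → Subset n) → Subset n → Subset n
  image P X = tabulate λ r → anyᵇ λ v → (v ∈ᵇ X) ∧ (r ∈ᵇ P v)

  image⁺ : (P : Fin n → Subset n) {X : Subset n} {v r : Fin n} → v ∈ X → r ∈ P v → r ∈ image P X
  image⁺ P {v = v} v∈X r∈ = ∈tabulate⁺ (T-any⁺ v (T-∧⁺ (∈⇒T v∈X) (∈⇒T r∈)))

  image⁻ : (P : Fin n → Subset n) {X : Subset n} {r : Fin n} → r ∈ image P X → ∃ λ v → v ∈ X × r ∈ P v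
  image⁻ P {X} r∈ with v , t ← T-any⁻ (∈tabulate⁻ r∈) with a , b ← T-∧⁻ {v ∈ᵇ X} t = v , T⇒∈ a , T⇒∈ b

  image-mono : (P : Fin n → Subset n) {X Y : Subset n} → X ⊆ Y → image P X ⊆ image P Y
  image-mono P X⊆Y r∈ with v , v∈X , r∈P ← image⁻ P r∈ = image⁺ P (X⊆Y v∈X) r∈P

  image-∪ : (P : Fin n → Subset n) (X Y : Subset n) → image P (X ∪ Y) ⊆ image P X ∪ image P Y
  image-∪ P X Y r∈ with v , v∈ , r∈P ← image⁻ P r∈ with x∈p∪q⁻ X Y v∈
  ... | inj₁ v∈X = x∈p∪q⁺ (inj₁ (image⁺ P v∈X r∈P))
  ... | inj₂ v∈Y = x∈p∪q⁺ (inj₂ (image⁺ P v∈Y r∈P))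

  image-∩ : (P : Fin n → Subset n) (X Y : Subset n) → image P (X ∩ Y) ⊆ image P X ∩ image P Y
  image-∩ P X Y r∈ = x∈p∩q⁺ (image-mono P (p∩q⊆p X Y) r∈ , image-mono P (p∩q⊆q X Y) r∈)

open Families

-- Matroid rank and span.

module MatroidRank {n : ℕ} {R : Subset n} (M : Matroid R) where
  open Matroid M

  -- The rank axioms concern subsets of `R` only; intersecting with `R` gives a monotone submodular
  -- function on all subsets.
  ρ : Subset n → ℕ
  ρ X = rank (X ∩ R)

  ρ-mono : (X Y : Subset n) → X ⊆ Y → ρ X ≤ ρ Y
  ρ-mono X Y X⊆Y = rank-mono (X ∩ R) (Y ∩ R) sub (p∩q⊆q Y R)
    where
    sub : X ∩ R ⊆ Y ∩ R
    sub x∈ with x∈X , x∈R ← x∈p∩q⁻ X R x∈ = x∈p∩q⁺ (X⊆Y x∈X , x∈R)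

  ρ-submod : (X Y : Subset n) {A B : Subset n} → A ⊆ X ∪ Y → B ⊆ X ∩ Y → ρ A + ρ B ≤ ρ X + ρ Y
  ρ-submod X Y {A} {B} A⊆ B⊆ = ≤-trans (+-mono-≤ (rank-mono (A ∩ R) _ A⊆′ (∪-⊆ (p∩q⊆q X R) (p∩q⊆q Y R)))
                                              (rank-mono (B ∩ R) _ B⊆′ (⊆-trans (p∩q⊆p (X ∩ R) (Y ∩ R)) (p∩q⊆q X R))))
                                      (rank-submod (X ∩ R) (Y ∩ R) (p∩q⊆q X R) (p∩q⊆q Y R))
    where
    A⊆′ : A ∩ R ⊆ (X ∩ R) ∪ (Y ∩ R)
    A⊆′ x∈ with x∈A , x∈R ← x∈p∩q⁻ A R x∈ with x∈p∪q⁻ X Y (A⊆ x∈A)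
    ... | inj₁ x∈X = x∈p∪q⁺ (inj₁ (x∈p∩q⁺ (x∈X , x∈R)))
    ... | inj₂ x∈Y = x∈p∪q⁺ (inj₂ (x∈p∩q⁺ (x∈Y , x∈R)))
    B⊆′ : B ∩ R ⊆ (X ∩ R) ∩ (Y ∩ R)
    B⊆′ x∈ with x∈B , x∈R ← x∈p∩q⁻ B R x∈ with x∈X , x∈Y ← x∈p∩q⁻ X Y (B⊆ x∈B) =
      x∈p∩q⁺ (x∈p∩q⁺ (x∈X , x∈R) , x∈p∩q⁺ (x∈Y , x∈R))

  ρ≡rank : (X : Subset n) → X ⊆ R → ρ X ≡ rank X
  ρ≡rank X X⊆R = cong rank (⊆-antisym (p∩q⊆p X R) (λ x∈ → x∈p∩q⁺ (x∈ , X⊆R x∈)))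

  ρ≤∣∣ : (X : Subset n) → ρ X ≤ ∣ X ∣
  ρ≤∣∣ X = ≤-trans (rank-bound (X ∩ R) (p∩q⊆q X R)) (card-mono (X ∩ R) X (p∩q⊆p X R))

  ρ≤rankR : (X : Subset n) → ρ X ≤ rank R
  ρ≤rankR X = rank-mono (X ∩ R) R (p∩q⊆q X R) id

  ρ-∪≤ : (X Y : Subset n) → ρ (X ∪ Y) ≤ ρ X + ∣ Y ∣
  ρ-∪≤ X Y = ≤-trans (m≤m+n _ _) (≤-trans (ρ-submod X Y {X ∪ Y} {X ∩ Y} id id) (+-monoʳ-≤ (ρ X) (ρ≤∣∣ Y)))

  InSpan : Fin n → Subset n → Set
  InSpan r X = ρ (X ∪ ⁅ r ⁆) ≤ ρ X

  inSpan? : ∀ r X → Dec (InSpan r X)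
  inSpan? r X = ρ (X ∪ ⁅ r ⁆) ≤? ρ X

  ∈⇒inSpan : ∀ r X → r ∈ X → InSpan r X
  ∈⇒inSpan r X r∈X = ρ-mono (X ∪ ⁅ r ⁆) X (∪-⊆ id (⁅⁆⊆ r∈X))

  -- Submodularity for `Y` and `X ∪ ⁅ r ⁆`: the union contains `Y ∪ ⁅ r ⁆`, the intersection
  -- contains `X`.
  inSpan-mono : ∀ r X Y → X ⊆ Y → InSpan r X → InSpan r Y
  inSpan-mono r X Y X⊆Y r∈ = +-cancelʳ-≤ (ρ X) _ _
    (≤-trans (ρ-submod Y (X ∪ ⁅ r ⁆) {Y ∪ ⁅ r ⁆} {X}
               (∪-mono id (q⊆p∪q X ⁅ r ⁆))
               (λ x∈ → x∈p∩q⁺ (X⊆Y x∈ , p⊆p∪q ⁅ r ⁆ x∈)))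
             (+-monoʳ-≤ (ρ Y) r∈))

  -- Induction on the size of `Y`: `X ∪ (Y - y)` and `X ∪ ⁅ y ⁆` have at most the rank of `X`, and
  -- their intersection contains `X`, so submodularity bounds their union.
  span-rank : ∀ X Y → (∀ y → y ∈ Y → InSpan y X) → ρ (X ∪ Y) ≤ ρ X
  span-rank X Y = go ∣ Y ∣ Y ≤-refl
    where
    go : ∀ N Y → ∣ Y ∣ ≤ N → (∀ y → y ∈ Y → InSpan y X) → ρ (X ∪ Y) ≤ ρ X
    go N Y ∣Y∣≤N sp with nonempty? Y
    ... | no empty = ρ-mono (X ∪ Y) X (∪-⊆ id (λ {y} y∈ → ⊥-elim (empty (y , y∈))))
    go zero Y ∣Y∣≤N sp | yes (y , y∈) = ⊥-elim (n≮0 (<-≤-trans (x∈p⇒∣p-x∣<∣p∣ {p = Y} y∈) ∣Y∣≤N))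
    go (suc N) Y ∣Y∣≤N sp | yes (y , y∈) = +-cancelʳ-≤ (ρ X) _ _
      (≤-trans (ρ-submod (X ∪ (Y - y)) (X ∪ ⁅ y ⁆) {X ∪ Y} {X} sub (λ x∈ → x∈p∩q⁺ (p⊆p∪q (Y - y) x∈ , p⊆p∪q ⁅ y ⁆ x∈)))
               (+-mono-≤ (go N (Y - y) (≤-pred (<-≤-trans (x∈p⇒∣p-x∣<∣p∣ {p = Y} y∈) ∣Y∣≤N))
                             (λ z z∈ → sp z (p─q⊆p Y ⁅ y ⁆ z∈)))
                         (sp y y∈)))
      where
      sub : X ∪ Y ⊆ (X ∪ (Y - y)) ∪ (X ∪ ⁅ y ⁆)
      sub {z} z∈ with x∈p∪q⁻ X Y z∈ | z ≟ y
      ... | inj₁ z∈X | _ = p⊆p∪q (X ∪ ⁅ y ⁆) (p⊆p∪q (Y - y) z∈X)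
      ... | inj₂ z∈Y | yes refl = q⊆p∪q (X ∪ (Y - y)) _ (q⊆p∪q X ⁅ y ⁆ (x∈⁅x⁆ y))
      ... | inj₂ z∈Y | no z≢y = p⊆p∪q (X ∪ ⁅ y ⁆) (q⊆p∪q X (Y - y) (x∈p∧x≢y⇒x∈p-y z∈Y z≢y))

  f : (Fin n → Subset n) → Subset n → ℕ
  f P X = ρ (image P X)

  f-submod : ∀ P X Y → f P (X ∪ Y) + f P (X ∩ Y) ≤ f P X + f P Y
  f-submod P X Y = ρ-submod (image P X) (image P Y) (image-∪ P X Y) (image-∩ P X Y)

-- Edges of a directed hypergraph that enter a set.

module Entering {n m : ℕ} (act : Fin m → Bool) (tl : Fin m → Subset n) (hd : Fin m → Fin n) where

  entᵇ : Fin m → Subset n → Bool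
  entᵇ i X = act i ∧ ((hd i ∈ᵇ X) ∧ nonemptyᵇ (tl i ─ X))

  ent⁺ : ∀ {i X w} → T (act i) → hd i ∈ X → w ∈ tl i → w ∉ X → T (entᵇ i X)
  ent⁺ a h w∈ w∉ = T-∧⁺ a (T-∧⁺ (∈⇒T h) (T-nonempty⁺ (_ , x∈p∧x∉q⇒x∈p─q w∈ w∉)))

  ent⁻ : ∀ {i X} → T (entᵇ i X) → T (act i) × hd i ∈ X × ∃ λ w → w ∈ tl i × w ∉ X
  ent⁻ {i} {X} t with a , t′ ← T-∧⁻ {act i} t with h , ne ← T-∧⁻ {hd i ∈ᵇ X} t′ with w , w∈ ← T-nonempty⁻ {X = tl i ─ X} ne =
    a , T⇒∈ h , w , ∈─⁻ w∈

  d : Subset n → ℕ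
  d X = cnt λ i → entᵇ i X

  -- Edge by edge: a tail vertex outside `X ∩ Y` misses `X` or `Y`. An edge entering both the union
  -- and the intersection has its head in both sets and a tail vertex outside both.
  d-submod : ∀ X Y → d (X ∪ Y) + d (X ∩ Y) ≤ d X + d Y
  d-submod X Y = cnt-+≤+ {p = λ i → entᵇ i (X ∪ Y)} {λ i → entᵇ i (X ∩ Y)} {λ i → entᵇ i X} {λ i → entᵇ i Y} λ i →
    bit-submod (union i) (inter i) (both i)
    where
    union : ∀ i → T (entᵇ i (X ∪ Y)) → T (entᵇ i X) ⊎ T (entᵇ i Y)
    union i t with a , h , w , w∈ , w∉ ← ent⁻ {i} {X ∪ Y} t with x∈p∪q⁻ X Y h
    ... | inj₁ h∈ = inj₁ (ent⁺ a h∈ w∈ (w∉ ∘ p⊆p∪q Y))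
    ... | inj₂ h∈ = inj₂ (ent⁺ a h∈ w∈ (w∉ ∘ q⊆p∪q X Y))
    inter : ∀ i → T (entᵇ i (X ∩ Y)) → T (entᵇ i X) ⊎ T (entᵇ i Y)
    inter i t with a , h , w , w∈ , w∉ ← ent⁻ {i} {X ∩ Y} t with hX , hY ← x∈p∩q⁻ X Y h with w ∈? X
    ... | yes w∈X = inj₂ (ent⁺ a hY w∈ (λ w∈Y → w∉ (x∈p∩q⁺ (w∈X , w∈Y))))
    ... | no w∉X = inj₁ (ent⁺ a hX w∈ w∉X)
    both : ∀ i → T (entᵇ i (X ∪ Y)) → T (entᵇ i (X ∩ Y)) → T (entᵇ i X) × T (entᵇ i Y)
    both i t t′ with a , h , w , w∈ , w∉ ← ent⁻ {i} {X ∪ Y} t with _ , h′ , _ ← ent⁻ {i} {X ∩ Y} t′ with hX , hY ← x∈p∩q⁻ X Y h′ =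
      ent⁺ a hX w∈ (w∉ ∘ p⊆p∪q Y) , ent⁺ a hY w∈ (w∉ ∘ q⊆p∪q X Y)

-- Disjoint families of parts and their uncrossing.

module Orientation {n : ℕ} (V : Subset n) where

  IsPart : Subset n → Set
  IsPart X = Nonempty X × X ⊆ V

  part-∪ : ∀ {X Y} → IsPart X → IsPart Y → IsPart (X ∪ Y)
  part-∪ {Y = Y} ((x , x∈X) , X⊆V) (_ , Y⊆V) = (x , p⊆p∪q Y x∈X) , ∪-⊆ X⊆V Y⊆V

  isPart? : ∀ X → Dec (IsPart X)
  isPart? X = nonempty? X ×-dec (X ⊆? V)

  ∀part? : {Q : Subset n → Set} → (∀ X → Dec (Q X)) → Dec (∀ X → IsPart X → Q X)
  ∀part? Q? with anySubset? (λ X → isPart? X ×-dec ¬? (Q? X))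
  ... | yes (X , X-part , ¬Q) = no λ h → ¬Q (h X X-part)
  ... | no none = yes λ X X-part → decidable-stable (Q? X) λ ¬Q → none (X , X-part , ¬Q)

  IntersectingSubmodular : (Subset n → ℕ) → Set
  IntersectingSubmodular g = ∀ X Y → IsPart X → IsPart Y → Nonempty (X ∩ Y) → g (X ∪ Y) + g (X ∩ Y) ≤ g X + g Y

  -- The indices of a disjoint family are its union, its number of members and its sum of `g`, so
  -- that uncrossing becomes arithmetic on indices.
  data Cover (g : Subset n → ℕ) : Subset n → ℕ → ℕ → Set where
    []   : Cover g ⊥ 0 0
    cons : ∀ X {Z c s} → IsPart X → Empty (X ∩ Z) → Cover g Z c s → Cover g (X ∪ Z) (suc c) (g X + s)

  cast : ∀ {g Z Z′ c c′ s s′} → Z ≡ Z′ → c ≡ c′ → s ≡ s′ → Cover g Z c s → Cover g Z′ c′ s′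
  cast refl refl refl C = C

  append : ∀ {g Y Z c c′ s s′} → Cover g Y c s → Cover g Z c′ s′ → Empty (Y ∩ Z) → Cover g (Y ∪ Z) (c + c′) (s + s′)
  append {Z = Z} [] D _ = cast (sym (∪-identityˡ Z)) refl refl D
  append {g} {Z = Z} {s′ = s′} (cons X {Y} {s = s} X-part X∩Y C) D disj =
    cast (sym (∪-assoc X Y Z)) refl (sym (+-assoc (g X) s s′))
      (cons X X-part X∩YZ (append C D λ { (x , x∈) → let a , b = x∈p∩q⁻ Y Z x∈ in disj (x , x∈p∩q⁺ (q⊆p∪q X Y a , b)) }))
    where
    X∩YZ : Empty (X ∩ (Y ∪ Z))
    X∩YZ (x , x∈) with a , b ← x∈p∩q⁻ X (Y ∪ Z) x∈ with x∈p∪q⁻ Y Z b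
    ... | inj₁ x∈Y = X∩Y (x , x∈p∩q⁺ (a , x∈Y))
    ... | inj₂ x∈Z = disj (x , x∈p∩q⁺ (p⊆p∪q Y a , x∈Z))

  family : ∀ {g Z c s} → Cover g Z c s → ∃ λ (X : Fin c → Subset n) →
           (∀ i → IsPart (X i)) × (∀ i → X i ⊆ Z) × (∀ i j → i ≢ j → Empty (X i ∩ X j)) × Σ[ g ∘ X ] ≡ s
  family [] = (λ ()) , (λ ()) , (λ ()) , (λ ()) , refl
  family {g} (cons Y {Z} {c} Y-part Y∩Z C) with X , X-part , X⊆Z , X-disj , refl ← family C =
    X⁺ , (λ { zero → Y-part ; (suc i) → X-part i }) ,
    (λ { zero → p⊆p∪q Z ; (suc i) → ⊆-trans (X⊆Z i) (q⊆p∪q Y Z) }) , disj , refl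
    where
    X⁺ : Fin (suc c) → Subset n
    X⁺ zero    = Y
    X⁺ (suc i) = X i
    disj : ∀ i j → i ≢ j → Empty (X⁺ i ∩ X⁺ j)
    disj zero    zero    i≢j = ⊥-elim (i≢j refl)
    disj zero    (suc j) _ (x , x∈) with a , b ← x∈p∩q⁻ Y (X j) x∈ = Y∩Z (x , x∈p∩q⁺ (a , X⊆Z j b))
    disj (suc i) zero    _ (x , x∈) with a , b ← x∈p∩q⁻ (X i) Y x∈ = Y∩Z (x , x∈p∩q⁺ (b , X⊆Z i a))
    disj (suc i) (suc j) i≢j = X-disj i j (i≢j ∘ cong suc)

  -- `A` is to be the union and `B` the intersection of what is uncrossed. The number of members is
  -- kept exactly, while the sum of `g` may drop.
  record Uncrossed (g : Subset n → ℕ) (A B : Subset n) (c s : ℕ) : Set where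
    constructor uncrossed
    field
      {c₁ c₂ s₁ s₂} : ℕ
      cover-∪ : Cover g A c₁ s₁
      cover-∩ : Cover g B c₂ s₂
      c-sum   : c₁ + c₂ ≡ c
      s-sum   : s₁ + s₂ ≤ s

  module _ (g : Subset n → ℕ) (g-submod : IntersectingSubmodular g) where

    -- `Y` passes the members one by one. A member disjoint from it stays; a member `X` that it
    -- meets is absorbed: `X ∪ Y` travels on, and `X ∩ Y` is set aside for the cover of the
    -- intersection.
    insert : ∀ {Z c s} Y → IsPart Y → Cover g Z c s → Uncrossed g (Z ∪ Y) (Z ∩ Y) (suc c) (s + g Y)
    insert Y Y-part [] = uncrossed
      (cast (trans (∪-identityʳ Y) (sym (∪-identityˡ Y))) refl refl (cons Y Y-part (λ { (x , x∈) → ∉⊥ (proj₂ (x∈p∩q⁻ Y ⊥ x∈)) }) []))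
      (cast (sym (∩-zeroˡ Y)) refl refl []) refl (≤-reflexive (trans (+-identityʳ (g Y + 0)) (+-identityʳ (g Y))))
    insert Y Y-part (cons X {Z} {c} {s} X-part X∩Z C) with nonempty? (X ∩ Y)
    ... | no X∩Y with uncrossed {c₁} {c₂} {s₁} {s₂} C₁ C₂ ceq sle ← insert Y Y-part C = uncrossed
          (cast (sym (∪-assoc X Z Y)) refl refl (cons X X-part X∩ZY C₁))
          (cast Z∩Y refl refl C₂)
          (cong suc ceq)
          (≤-trans (≤-reflexive (+-assoc (g X) s₁ s₂)) (≤-trans (+-monoʳ-≤ (g X) sle) (≤-reflexive (sym (+-assoc (g X) s (g Y))))))
          where
          X∩ZY : Empty (X ∩ (Z ∪ Y))
          X∩ZY (x , x∈) with a , b ← x∈p∩q⁻ X (Z ∪ Y) x∈ with x∈p∪q⁻ Z Y b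
          ... | inj₁ x∈Z = X∩Z (x , x∈p∩q⁺ (a , x∈Z))
          ... | inj₂ x∈Y = X∩Y (x , x∈p∩q⁺ (a , x∈Y))
          Z∩Y : Z ∩ Y ≡ (X ∪ Z) ∩ Y
          Z∩Y = sym (trans (∩-distribʳ-∪ Y X Z) (trans (cong (_∪ Z ∩ Y) (Empty-unique X∩Y)) (∪-identityˡ (Z ∩ Y))))
    ... | yes X∩Y with uncrossed {c₁} {c₂} {s₁} {s₂} C₁ C₂ ceq sle ← insert (X ∪ Y) (part-∪ X-part Y-part) C = uncrossed
          (cast (⊆-antisym (∪-⊆ (λ z → p⊆p∪q Y (q⊆p∪q X Z z)) (∪-⊆ (λ x → p⊆p∪q Y (p⊆p∪q Z x)) (q⊆p∪q (X ∪ Z) Y)))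
                           (∪-⊆ (∪-⊆ (λ x → q⊆p∪q Z (X ∪ Y) (p⊆p∪q Y x)) (p⊆p∪q (X ∪ Y))) (λ y → q⊆p∪q Z (X ∪ Y) (q⊆p∪q X Y y))))
                refl refl C₁)
          (cast (sym (∩-distribʳ-∪ Y X Z)) refl refl
            (cons (X ∩ Y) (X∩Y , ⊆-trans (p∩q⊆p X Y) (proj₂ X-part)) disj (cast Z∩XY refl refl C₂)))
          (trans (+-suc c₁ c₂) (cong suc ceq))
          -- The recursive call inserts `X ∪ Y`, so its bound has `g (X ∪ Y)` on the right;
          -- submodularity puts the same term on the left.
          (+-cancelˡ-≤ (g (X ∪ Y)) _ _ (begin
            g (X ∪ Y) + (s₁ + (g (X ∩ Y) + s₂))   ≡⟨ arith₁ (g (X ∪ Y)) s₁ (g (X ∩ Y)) s₂ ⟩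
            (g (X ∪ Y) + g (X ∩ Y)) + (s₁ + s₂)   ≤⟨ +-mono-≤ (g-submod X Y X-part Y-part X∩Y) sle ⟩
            (g X + g Y) + (s + g (X ∪ Y))         ≡⟨ arith₂ (g X) (g Y) s (g (X ∪ Y)) ⟩
            g (X ∪ Y) + (g X + s + g Y)           ∎))
          where
          open ≤-Reasoning
          arith₁ : ∀ a b c d → a + (b + (c + d)) ≡ (a + c) + (b + d)
          arith₁ = solve-∀
          arith₂ : ∀ a b c d → (a + b) + (c + d) ≡ d + (a + c + b)
          arith₂ = solve-∀
          disj : Empty ((X ∩ Y) ∩ (Z ∩ Y))
          disj (x , x∈) with a , b ← x∈p∩q⁻ (X ∩ Y) (Z ∩ Y) x∈ = X∩Z (x , x∈p∩q⁺ (p∩q⊆p X Y a , p∩q⊆p Z Y b))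
          Z∩XY : Z ∩ (X ∪ Y) ≡ Z ∩ Y
          Z∩XY = ⊆-antisym to (λ x∈ → let a , b = x∈p∩q⁻ Z Y x∈ in x∈p∩q⁺ (a , q⊆p∪q X Y b))
            where
            to : Z ∩ (X ∪ Y) ⊆ Z ∩ Y
            to {x} x∈ with a , b ← x∈p∩q⁻ Z (X ∪ Y) x∈ with x∈p∪q⁻ X Y b
            ... | inj₁ x∈X = ⊥-elim (X∩Z (x , x∈p∩q⁺ (x∈X , a)))
            ... | inj₂ x∈Y = x∈p∩q⁺ (a , x∈Y)

    -- The members of the second cover are inserted one after another. Since `X` misses `Z`, it
    -- meets `Y ∪ Z` only inside `Y`, and what it cuts off can be appended to the cover of `Y ∩ Z`.
    uncross : ∀ {Y Z c c′ s s′} → Cover g Y c s → Cover g Z c′ s′ → Uncrossed g (Y ∪ Z) (Y ∩ Z) (c + c′) (s + s′)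
    uncross {Y} {c = c} {s = s} C [] = uncrossed
      (cast (sym (∪-identityʳ Y)) refl refl C) (cast (sym (∩-zeroʳ Y)) refl refl []) refl ≤-refl
    uncross {Y} {c = c} {s = s} C (cons X {Z} {c′} {s′} X-part X∩Z D)
      with uncrossed {a₁} {a₂} {t₁} {t₂} C₁ C₂ ceq sle ← uncross C D
      with uncrossed {b₁} {b₂} {u₁} {u₂} D₁ D₂ deq ule ← insert X X-part C₁ = uncrossed
        (cast (⊆-antisym (∪-⊆ (∪-mono id (q⊆p∪q X Z)) (λ x → q⊆p∪q Y (X ∪ Z) (p⊆p∪q Z x)))
                         (∪-⊆ (λ y → p⊆p∪q X (p⊆p∪q Z y)) (∪-⊆ (q⊆p∪q (Y ∪ Z) X) (λ z → p⊆p∪q X (q⊆p∪q Y Z z))))) refl refl D₁)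
        (cast (⊆-antisym to from) refl refl (append D₂ C₂ disj))
        (trans (sym (+-assoc b₁ b₂ a₂)) (trans (cong (_+ a₂) deq) (trans (cong suc ceq) (sym (+-suc c c′)))))
        (begin
          u₁ + (u₂ + t₂)     ≡⟨ +-assoc u₁ u₂ t₂ ⟨
          (u₁ + u₂) + t₂     ≤⟨ +-monoˡ-≤ t₂ ule ⟩
          t₁ + g X + t₂      ≡⟨ arith₁ t₁ (g X) t₂ ⟩
          g X + (t₁ + t₂)    ≤⟨ +-monoʳ-≤ (g X) sle ⟩
          g X + (s + s′)     ≡⟨ arith₂ (g X) s s′ ⟩
          s + (g X + s′)     ∎)
      where
      open ≤-Reasoning
      arith₁ : ∀ a b c → a + b + c ≡ b + (a + c)
      arith₁ = solve-∀
      arith₂ : ∀ a b c → a + (b + c) ≡ b + (a + c)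
      arith₂ = solve-∀
      to : (Y ∪ Z) ∩ X ∪ Y ∩ Z ⊆ Y ∩ (X ∪ Z)
      to {x} x∈ with x∈p∪q⁻ ((Y ∪ Z) ∩ X) (Y ∩ Z) x∈
      ... | inj₂ x∈YZ with a , b ← x∈p∩q⁻ Y Z x∈YZ = x∈p∩q⁺ (a , q⊆p∪q X Z b)
      ... | inj₁ x∈YZX with a , b ← x∈p∩q⁻ (Y ∪ Z) X x∈YZX with x∈p∪q⁻ Y Z a
      ...   | inj₁ x∈Y = x∈p∩q⁺ (x∈Y , p⊆p∪q Z b)
      ...   | inj₂ x∈Z = ⊥-elim (X∩Z (x , x∈p∩q⁺ (b , x∈Z)))
      from : Y ∩ (X ∪ Z) ⊆ (Y ∪ Z) ∩ X ∪ Y ∩ Z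
      from x∈ with a , b ← x∈p∩q⁻ Y (X ∪ Z) x∈ with x∈p∪q⁻ X Z b
      ... | inj₁ x∈X = x∈p∪q⁺ (inj₁ (x∈p∩q⁺ (p⊆p∪q Z a , x∈X)))
      ... | inj₂ x∈Z = x∈p∪q⁺ (inj₂ (x∈p∩q⁺ (a , x∈Z)))
      disj : Empty (((Y ∪ Z) ∩ X) ∩ (Y ∩ Z))
      disj (x , x∈) with a , b ← x∈p∩q⁻ ((Y ∪ Z) ∩ X) (Y ∩ Z) x∈ =
        X∩Z (x , x∈p∩q⁺ (p∩q⊆q (Y ∪ Z) X a , p∩q⊆q Y Z b))

-- Choosing heads for the hyperedges.

module Orient {n : ℕ} (V : Subset n) (K : ℕ) where
  open Orientation V

  meets : {k : ℕ} → (Fin k → Subset n) → Subset n → ℕ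
  meets hedge Z = cnt λ e → nonemptyᵇ (hedge e ∩ Z)

  meets-submod : {k : ℕ} (hedge : Fin k → Subset n) (Y Z : Subset n) →
                 meets hedge (Y ∪ Z) + meets hedge (Y ∩ Z) ≤ meets hedge Y + meets hedge Z
  meets-submod hedge Y Z =
    cnt-+≤+ {p = λ e → nonemptyᵇ (hedge e ∩ (Y ∪ Z))} {λ e → nonemptyᵇ (hedge e ∩ (Y ∩ Z))} {λ e → nonemptyᵇ (hedge e ∩ Y)} {λ e → nonemptyᵇ (hedge e ∩ Z)}
      λ e → bit-submod (union e) (inj₁ ∘ proj₁ ∘ inter e) (λ _ → inter e)
    where
    union : ∀ e → T (nonemptyᵇ (hedge e ∩ (Y ∪ Z))) → T (nonemptyᵇ (hedge e ∩ Y)) ⊎ T (nonemptyᵇ (hedge e ∩ Z))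
    union e t with x , x∈ ← T-nonempty⁻ {X = hedge e ∩ (Y ∪ Z)} t with a , b ← x∈p∩q⁻ (hedge e) (Y ∪ Z) x∈ with x∈p∪q⁻ Y Z b
    ... | inj₁ x∈Y = inj₁ (T-nonempty⁺ (x , x∈p∩q⁺ (a , x∈Y)))
    ... | inj₂ x∈Z = inj₂ (T-nonempty⁺ (x , x∈p∩q⁺ (a , x∈Z)))
    inter : ∀ e → T (nonemptyᵇ (hedge e ∩ (Y ∩ Z))) → T (nonemptyᵇ (hedge e ∩ Y)) × T (nonemptyᵇ (hedge e ∩ Z))
    inter e t with x , x∈ ← T-nonempty⁻ {X = hedge e ∩ (Y ∩ Z)} t with a , b ← x∈p∩q⁻ (hedge e) (Y ∩ Z) x∈ with c , d ← x∈p∩q⁻ Y Z b =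
      T-nonempty⁺ (x , x∈p∩q⁺ (a , c)) , T-nonempty⁺ (x , x∈p∩q⁺ (a , d))

  -- Each member of a disjoint family demands `K`. A hyperedge without a head can help once,
  -- anywhere in the union `Z`; `g` is the supply already fixed for each part.
  CoverBound : {k : ℕ} → (Fin k → Subset n) → (Subset n → ℕ) → Set
  CoverBound hedge g = ∀ {Z c s} → Cover g Z c s → K * c ≤ meets hedge Z + s

  _⊕_ : (Subset n → ℕ) → Fin n → Subset n → ℕ
  (g ⊕ v) X = g X + bit (v ∈ᵇ X)

  -- Heads are chosen successively, each adding its indicator to the supply. In this form the choice
  -- is a finite search, hence decidable, and its existence may be proved by contradiction.
  Oriented : (k : ℕ) → (Fin k → Subset n) → (Subset n → ℕ) → Set
  Oriented zero    hedge g = ∀ X → IsPart X → K ≤ g X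
  Oriented (suc k) hedge g = ∃ λ v → v ∈ hedge zero × Oriented k (hedge ∘ suc) (g ⊕ v)

  oriented? : ∀ k hedge g → Dec (Oriented k hedge g)
  oriented? zero    hedge g = ∀part? λ X → K ≤? g X
  oriented? (suc k) hedge g = any? λ v → (v ∈? hedge zero) ×-dec oriented? k (hedge ∘ suc) (g ⊕ v)

  bit-∪∩ : ∀ (v : Fin n) X Y → bit (v ∈ᵇ (X ∪ Y)) + bit (v ∈ᵇ (X ∩ Y)) ≤ bit (v ∈ᵇ X) + bit (v ∈ᵇ Y)
  bit-∪∩ v X Y = bit-submod
    (λ t → [ inj₁ ∘ ∈⇒T , inj₂ ∘ ∈⇒T ] (x∈p∪q⁻ X Y (T⇒∈ t)))
    (λ t → inj₁ (∈⇒T (p∩q⊆p X Y (T⇒∈ t))))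
    (λ _ t → ∈⇒T (p∩q⊆p X Y (T⇒∈ t)) , ∈⇒T (p∩q⊆q X Y (T⇒∈ t)))

  ⊕-submod : ∀ {g} v → IntersectingSubmodular g → IntersectingSubmodular (g ⊕ v)
  ⊕-submod {g} v g-submod X Y X-part Y-part X∩Y = begin
    g (X ∪ Y) + bit (v ∈ᵇ (X ∪ Y)) + (g (X ∩ Y) + bit (v ∈ᵇ (X ∩ Y)))
      ≡⟨ +-interchange (g (X ∪ Y)) _ (g (X ∩ Y)) _ ⟩
    (g (X ∪ Y) + g (X ∩ Y)) + (bit (v ∈ᵇ (X ∪ Y)) + bit (v ∈ᵇ (X ∩ Y)))
      ≤⟨ +-mono-≤ (g-submod X Y X-part Y-part X∩Y) (bit-∪∩ v X Y) ⟩
    (g X + g Y) + (bit (v ∈ᵇ X) + bit (v ∈ᵇ Y))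
      ≡⟨ +-interchange (g X) (g Y) _ _ ⟩
    g X + bit (v ∈ᵇ X) + (g Y + bit (v ∈ᵇ Y)) ∎
    where open ≤-Reasoning

  -- If `v` lies in the union it lies in some member, so the indicators of `v` add at least one to
  -- the sum.
  unshift : ∀ {g v Z c s} → Cover (g ⊕ v) Z c s → ∃ λ s′ → Cover g Z c s′ × s′ + bit (v ∈ᵇ Z) ≤ s
  unshift {v = v} [] = 0 , [] , ≤-reflexive (¬T⇒bit≡0 (λ t → ∉⊥ (T⇒∈ {x = v} {⊥} t)))
  unshift {g} {v} (cons X {Z} {s = s} X-part X∩Z C) with s′ , C′ , le ← unshift C =
    g X + s′ , cons X X-part X∩Z C′ , (begin
      g X + s′ + bit (v ∈ᵇ (X ∪ Z))               ≤⟨ +-monoʳ-≤ (g X + s′) (m+n≤o⇒m≤o _ (bit-∪∩ v X Z)) ⟩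
      g X + s′ + (bit (v ∈ᵇ X) + bit (v ∈ᵇ Z))    ≡⟨ +-interchange (g X) s′ _ _ ⟩
      g X + bit (v ∈ᵇ X) + (s′ + bit (v ∈ᵇ Z))    ≤⟨ +-monoʳ-≤ (g X + bit (v ∈ᵇ X)) le ⟩
      g X + bit (v ∈ᵇ X) + s                      ∎)
    where open ≤-Reasoning

  -- hedge lists the hyperedges other than e₀; the bound fails for them alone, so e₀ is needed on Z.
  record Tight {k : ℕ} (hedge : Fin k → Subset n) (g : Subset n → ℕ) (e₀ Z : Subset n) : Set where
    constructor tight
    field
      {c s}  : ℕ
      cover  : Cover g Z c s
      met    : Nonempty (e₀ ∩ Z)
      bound  : suc (meets hedge Z + s) ≤ K * c

  module _ {k : ℕ} (hedge : Fin (suc k) → Subset n) (g : Subset n → ℕ)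
           (g-submod : IntersectingSubmodular g) (cb : CoverBound hedge g) where

    private
      e₀ = hedge zero
      rest = hedge ∘ suc

    cb′ : ∀ {Z c s} → Cover g Z c s → K * c ≤ bit (nonemptyᵇ (e₀ ∩ Z)) + (meets rest Z + s)
    cb′ {Z} {s = s} C = ≤-trans (cb C) (≤-reflexive (trans (cong (_+ s) (cnt-suc (λ e → nonemptyᵇ (hedge e ∩ Z))))
                                                     (+-assoc (bit (nonemptyᵇ (e₀ ∩ Z))) _ s)))

    -- Uncross the two deficient covers. Together they fall short by at least two; on the union `e₀`
    -- makes up for at most one, so a shortage remains on the intersection, and `e₀` must meet it.
    tight-∩ : ∀ {Y Z} → Tight rest g e₀ Y → Tight rest g e₀ Z → Tight rest g e₀ (Y ∩ Z)
    tight-∩ {Y} {Z} (tight {c} {s} C _ le) (tight {c′} {s′} C′ _ le′)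
      with uncrossed {c₁} {c₂} {s₁} {s₂} D₁ D₂ ceq sle ← uncross g g-submod C C′ = tight D₂ met slack
      where
      open ≤-Reasoning
      arith₁ : ∀ a b c d → suc (a + b) + suc (c + d) ≡ 2 + ((a + c) + (b + d))
      arith₁ = solve-∀
      arith₂ : ∀ a b c d → 2 + ((a + c) + (b + d)) ≡ suc (a + b) + suc (c + d)
      arith₂ = solve-∀
      slack : suc (meets rest (Y ∩ Z) + s₂) ≤ K * c₂
      slack = +-cancelˡ-≤ (suc (meets rest (Y ∪ Z) + s₁)) _ _ (begin
        suc (meets rest (Y ∪ Z) + s₁) + suc (meets rest (Y ∩ Z) + s₂)
          ≡⟨ arith₁ (meets rest (Y ∪ Z)) s₁ (meets rest (Y ∩ Z)) s₂ ⟩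
        2 + ((meets rest (Y ∪ Z) + meets rest (Y ∩ Z)) + (s₁ + s₂))
          ≤⟨ +-monoʳ-≤ 2 (+-mono-≤ (meets-submod rest Y Z) sle) ⟩
        2 + ((meets rest Y + meets rest Z) + (s + s′))
          ≡⟨ arith₂ (meets rest Y) s (meets rest Z) s′ ⟩
        suc (meets rest Y + s) + suc (meets rest Z + s′)
          ≤⟨ +-mono-≤ le le′ ⟩
        K * c + K * c′
          ≡⟨ *-distribˡ-+ K c c′ ⟨
        K * (c + c′)
          ≡⟨ cong (K *_) ceq ⟨
        K * (c₁ + c₂)
          ≡⟨ *-distribˡ-+ K c₁ c₂ ⟩
        K * c₁ + K * c₂
          ≤⟨ +-monoˡ-≤ (K * c₂) (≤-trans (cb′ D₁) (+-monoˡ-≤ _ (bit≤1 (nonemptyᵇ (e₀ ∩ (Y ∪ Z)))))) ⟩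
        suc (meets rest (Y ∪ Z) + s₁) + K * c₂ ∎)
      met : Nonempty (e₀ ∩ (Y ∩ Z))
      met with nonempty? (e₀ ∩ (Y ∩ Z))
      ... | yes ne = ne
      ... | no empty = ⊥-elim (<⇒≱ slack (≤-trans (cb′ D₂)
              (≤-reflexive (cong (_+ (meets rest (Y ∩ Z) + s₂)) (¬T⇒bit≡0 (λ t → empty (T-nonempty⁻ t)))))))

    -- A cover that violates the bound for `g ⊕ v` satisfies it for `g` with `e₀` added. So `e₀`
    -- contributes more than `v` does: `e₀` meets the union and `v` is not in it.
    avoiding-tight : ∀ v → ¬ CoverBound rest (g ⊕ v) → ¬ ¬ (∃ λ Z → Tight rest g e₀ Z × v ∉ Z)
    avoiding-tight v violated none = violated λ C → ≮⇒≥ λ lt → none (extract C lt)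
      where
      open ≤-Reasoning
      extract : ∀ {Z c s} → Cover (g ⊕ v) Z c s → meets rest Z + s < K * c → ∃ λ Z → Tight rest g e₀ Z × v ∉ Z
      extract {Z} {c} {s} C lt with s′ , C′ , le ← unshift C =
        Z , tight C′ met (≤-trans (s≤s (+-monoʳ-≤ (meets rest Z) (m+n≤o⇒m≤o s′ le))) lt) , v∉Z
        where
        v<e₀ : bit (v ∈ᵇ Z) < bit (nonemptyᵇ (e₀ ∩ Z))
        v<e₀ = +-cancelʳ-< (meets rest Z + s′) _ _ (begin-strict
          bit (v ∈ᵇ Z) + (meets rest Z + s′)             ≡⟨ trans (+-comm (bit (v ∈ᵇ Z)) _) (+-assoc (meets rest Z) s′ _) ⟩
          meets rest Z + (s′ + bit (v ∈ᵇ Z))             ≤⟨ +-monoʳ-≤ (meets rest Z) le ⟩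
          meets rest Z + s                               <⟨ lt ⟩
          K * c                                          ≤⟨ cb′ C′ ⟩
          bit (nonemptyᵇ (e₀ ∩ Z)) + (meets rest Z + s′) ∎)
        met : Nonempty (e₀ ∩ Z)
        met with nonempty? (e₀ ∩ Z)
        ... | yes ne = ne
        ... | no empty = ⊥-elim (n≮0 (subst (bit (v ∈ᵇ Z) <_) (¬T⇒bit≡0 (λ t → empty (T-nonempty⁻ t))) v<e₀))
        v∉Z : v ∉ Z
        v∉Z v∈Z = <⇒≱ v<e₀ (≤-trans (bit≤1 (nonemptyᵇ (e₀ ∩ Z))) (≤-reflexive (sym (T⇒bit≡1 (∈⇒T v∈Z)))))

    -- If every v ∈ e₀ failed as head, each would be avoided by a tight set; intersecting these shrinks a tight set indefinitely.
    some-head : Nonempty e₀ → ¬ (∀ v → v ∈ e₀ → ¬ CoverBound rest (g ⊕ v))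
    some-head (v₀ , v₀∈) violated = avoiding-tight v₀ (violated v₀ v₀∈) λ (Z , Z-tight , _) → descend ∣ Z ∣ ≤-refl Z-tight
      where
      descend : ∀ N {Z} → ∣ Z ∣ ≤ N → ¬ Tight rest g e₀ Z
      descend N {Z} ∣Z∣≤N Z-tight with v , v∈ ← Tight.met Z-tight with v∈e₀ , v∈Z ← x∈p∩q⁻ e₀ Z v∈ =
        avoiding-tight v (violated v v∈e₀) λ (Y , Y-tight , v∉Y) →
          shrink N Y ∣Z∣≤N (p⊂q⇒∣p∣<∣q∣ {p = Z ∩ Y} {Z} (p∩q⊆p Z Y , v , v∈Z , v∉Y ∘ p∩q⊆q Z Y)) (tight-∩ Z-tight Y-tight)
        where
        shrink : ∀ N Y → ∣ Z ∣ ≤ N → ∣ Z ∩ Y ∣ < ∣ Z ∣ → ¬ Tight rest g e₀ (Z ∩ Y)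
        shrink zero    Y ≤N <Z = ⊥-elim (n≮0 (<-≤-trans <Z ≤N))
        shrink (suc N) Y ≤N <Z = descend N (≤-pred (<-≤-trans <Z ≤N))

  -- If no choice of heads existed, then by induction no head of the first hyperedge could preserve
  -- the bound, contrary to `some-head`.
  orient : ∀ k (hedge : Fin k → Subset n) → (∀ e → Nonempty (hedge e)) → ∀ g → IntersectingSubmodular g →
           CoverBound hedge g → Oriented k hedge g
  orient zero hedge _ g g-submod cb X X-part = subst₂ _≤_ (*-identityʳ K) (+-identityʳ (g X))
    (cb (cons X X-part (λ { (x , x∈) → ∉⊥ (proj₂ (x∈p∩q⁻ X ⊥ x∈)) }) []))
  orient (suc k) hedge hedge-ne g g-submod cb = decidable-stable (oriented? (suc k) hedge g) λ ¬oriented →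
    some-head hedge g g-submod cb (hedge-ne zero) λ v v∈ cb-v →
      ¬oriented (v , v∈ , orient k (hedge ∘ suc) (hedge-ne ∘ suc) (g ⊕ v) (⊕-submod {g} v g-submod) cb-v)

  heads : ∀ k (hedge : Fin k → Subset n) g → Oriented k hedge g →
          ∃ λ (hv : Fin k → Fin n) → (∀ e → hv e ∈ hedge e) × (∀ X → IsPart X → K ≤ g X + cnt (λ e → hv e ∈ᵇ X))
  heads zero hedge g o = (λ ()) , (λ ()) , λ X X-part → ≤-trans (o X X-part) (m≤m+n (g X) _)
  heads (suc k) hedge g (v , v∈ , o) with hv , hv∈ , le ← heads k (hedge ∘ suc) (g ⊕ v) o =
    (λ { zero → v ; (suc e) → hv e }) , (λ { zero → v∈ ; (suc e) → hv∈ e }) ,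
    λ X X-part → ≤-trans (le X X-part) (≤-reflexive (trans (+-assoc (g X) _ _)
      (cong (g X +_) (sym (cnt-suc (λ { zero → v ∈ᵇ X ; (suc e) → hv e ∈ᵇ X }))))))

-- Arborescences and their growth by one arc.

module Arborescence {n m : ℕ} where

  module Directed (src tgt : Fin m → Fin n) (sel : Fin m → Bool) (r : Fin n) where

    root∈VS : r ∈ VS src tgt sel r
    root∈VS = ∈tabulate⁺ (T-∨⁺ {r == r} (inj₁ (T-==⁺ refl)))

    src∈VS : ∀ i → T (sel i) → src i ∈ VS src tgt sel r
    src∈VS i t = ∈tabulate⁺ (T-∨⁺ {src i == r} (inj₂ (T-any⁺ i (T-∧⁺ t (T-∨⁺ (inj₁ (T-==⁺ {u = src i} refl)))))))

    tgt∈VS : ∀ i → T (sel i) → tgt i ∈ VS src tgt sel r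
    tgt∈VS i t = ∈tabulate⁺ (T-∨⁺ {tgt i == r} (inj₂ (T-any⁺ i (T-∧⁺ t (T-∨⁺ (inj₂ (T-==⁺ {u = tgt i} refl)))))))

    VS⁻ : ∀ {v} → v ∈ VS src tgt sel r → v ≡ r ⊎ ∃ λ i → T (sel i) × (src i ≡ v ⊎ tgt i ≡ v)
    VS⁻ {v} v∈ with T-∨⁻ {v == r} (∈tabulate⁻ v∈)
    ... | inj₁ t = inj₁ (T-==⁻ t)
    ... | inj₂ t with i , ti ← T-any⁻ t with s , e ← T-∧⁻ {sel i} ti with T-∨⁻ {src i == v} e
    ...   | inj₁ a = inj₂ (i , s , inj₁ (T-==⁻ a))
    ...   | inj₂ b = inj₂ (i , s , inj₂ (T-==⁻ b))

    -- `Reach` follows arcs in either direction; finding an arc that enters a set needs a path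
    -- directed away from `r`.
    data DReach : Fin n → Set where
      here : DReach r
      step : ∀ i → T (sel i) → DReach (src i) → DReach (tgt i)

    -- The in-arc of a vertex is unique, so walking an arc backwards stays within the directed paths from r.
    Reach⇒DReach : IsArborescence src tgt sel r → ∀ {v} → Reach src tgt sel r v → DReach v
    Reach⇒DReach arb here = here
    Reach⇒DReach arb (step i t (inj₁ (refl , refl)) reach) = step i t (Reach⇒DReach arb reach)
    Reach⇒DReach (tree , r-indeg , indeg-1) (step i t (inj₂ (refl , refl)) reach) = back i t (Reach⇒DReach (tree , r-indeg , indeg-1) reach) refl
      where
      back : ∀ i → T (sel i) → ∀ {u} → DReach u → u ≡ tgt i → DReach (src i)
      back i t here eq = ⊥-elim (cnt≡0⇒¬T {p = λ j → sel j ∧ (tgt j == r)} r-indeg i (T-∧⁺ t (T-==⁺ (sym eq))))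
      back i t (step j t′ reach′) eq with tgt i ≟ r
      ... | yes e = ⊥-elim (cnt≡0⇒¬T {p = λ j → sel j ∧ (tgt j == r)} r-indeg i (T-∧⁺ t (T-==⁺ e)))
      ... | no ≢r = subst (DReach ∘ src) (cnt≡1⇒unique (λ j → sel j ∧ (tgt j == tgt i)) (indeg-1 (tgt i) (tgt∈VS i t) ≢r)
                      (T-∧⁺ t′ (T-==⁺ eq)) (T-∧⁺ t (T-==⁺ refl))) reach′

    -- Walking back from `v`, the path leaves `X` before it reaches `r`. The path to the tail of the
    -- arc is returned as well, to show later that a tail in `R` can only be `r`.
    entering-arc : ∀ {X v} → r ∉ X → v ∈ X → DReach v → ∃ λ i → T (sel i) × DReach (src i) × src i ∉ X × tgt i ∈ X
    entering-arc r∉X r∈X here = ⊥-elim (r∉X r∈X)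
    entering-arc {X} r∉X v∈X (step i t reach) with src i ∈? X
    ... | yes ∈X = entering-arc r∉X ∈X reach
    ... | no ∉X = i , t , reach , ∉X , v∈X

    single-arborescence : (∀ i → ¬ T (sel i)) → IsArborescence src tgt sel r
    single-arborescence none =
      ((λ v v∈ → [ (λ { refl → here }) , (λ (i , t , _) → ⊥-elim (none i t)) ] (VS⁻ v∈)) ,
        trans (cong (_+ 1) (cnt≡0 none)) (trans (sym (∣⁅x⁆∣≡1 r)) (cong ∣_∣ (⊆-antisym (⁅⁆⊆ root∈VS)
          (λ v∈ → [ (λ { refl → x∈⁅x⁆ r }) , (λ (i , t , _) → ⊥-elim (none i t)) ] (VS⁻ v∈)))))) ,
      cnt≡0 (λ i t → none i (proj₁ (T-∧⁻ {sel i} t))) ,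
      λ v v∈ v≢r → ⊥-elim ([ v≢r , (λ (i , t , _) → none i t) ] (VS⁻ v∈))

  -- Arcs have to agree on selected indices only, so the source of an unassigned edge may be chosen
  -- anew.
  module Congruence {src src′ tgt tgt′ : Fin m → Fin n} {sel sel′ : Fin m → Bool} (r : Fin n)
           (sel≗ : ∀ i → sel i ≡ sel′ i) (arc≗ : ∀ i → T (sel i) → src i ≡ src′ i × tgt i ≡ tgt′ i) where

    VS-cong : VS src tgt sel r ≡ VS src′ tgt′ sel′ r
    VS-cong = tabulate-cong λ v → cong ((v == r) ∨_) (cong ∣0<∣ (tabulate-cong (pointwise v)))
      where
      ∣0<∣ : Subset m → Bool
      ∣0<∣ = nonemptyᵇ
      pointwise : ∀ v i → (sel i ∧ ((src i == v) ∨ (tgt i == v))) ≡ (sel′ i ∧ ((src′ i == v) ∨ (tgt′ i == v)))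
      pointwise v i with sel i | sel′ i | sel≗ i | arc≗ i
      ... | true | true | refl | eqs with a , b ← eqs tt rewrite a | b = refl
      ... | false | false | refl | _ = refl

    Reach-cong : ∀ {v} → Reach src tgt sel r v → Reach src′ tgt′ sel′ r v
    Reach-cong here = here
    Reach-cong (step i t e reach) with a , b ← arc≗ i t =
      step i (subst T (sel≗ i) t) (subst₂ (λ x y → (x ≡ _ × y ≡ _) ⊎ (y ≡ _ × x ≡ _)) a b e) (Reach-cong reach)

    indeg-cong : ∀ v → indeg src tgt sel r v ≡ indeg src′ tgt′ sel′ r v
    indeg-cong v = cnt-cong pointwise
      where
      pointwise : ∀ i → (sel i ∧ (tgt i == v)) ≡ (sel′ i ∧ (tgt′ i == v))
      pointwise i with sel i | sel′ i | sel≗ i | arc≗ i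
      ... | true | true | refl | eqs rewrite proj₂ (eqs tt) = refl
      ... | false | false | refl | _ = refl

    arborescence-cong : IsArborescence src tgt sel r → IsArborescence src′ tgt′ sel′ r
    arborescence-cong ((reach , size) , r-indeg , indeg-1) =
      ((λ v v∈ → Reach-cong (reach v (subst (v ∈_) (sym VS-cong) v∈))) ,
        trans (cong (_+ 1) (sym (cnt-cong sel≗))) (trans size (cong ∣_∣ VS-cong))) ,
      trans (sym (indeg-cong r)) r-indeg ,
      λ v v∈ v≢r → trans (sym (indeg-cong v)) (indeg-1 v (subst (v ∈_) (sym VS-cong) v∈) v≢r)

  module Extension {src tgt : Fin m → Fin n} {sel sel′ : Fin m → Bool} {r : Fin n} (i : Fin m)
           (¬sel-i : ¬ T (sel i)) (sel′-i : T (sel′ i)) (same : ∀ j → j ≢ i → sel′ j ≡ sel j)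
           (src∈ : src i ∈ VS src tgt sel r) (tgt∉ : tgt i ∉ VS src tgt sel r) where

    private
      module Old = Directed src tgt sel r
      module New = Directed src tgt sel′ r

    sel⇒sel′ : ∀ j → T (sel j) → T (sel′ j)
    sel⇒sel′ j t with j ≟ i
    ... | yes refl = sel′-i
    ... | no j≢i = subst T (sym (same j j≢i)) t

    sel′⇒ : ∀ j → T (sel′ j) → j ≡ i ⊎ T (sel j)
    sel′⇒ j t with j ≟ i
    ... | yes j≡i = inj₁ j≡i
    ... | no j≢i = inj₂ (subst T (same j j≢i) t)

    VS-extend : VS src tgt sel′ r ≡ VS src tgt sel r ∪ ⁅ tgt i ⁆
    VS-extend = ⊆-antisym to (∪-⊆ old (⁅⁆⊆ (New.tgt∈VS i sel′-i)))
      where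
      old : VS src tgt sel r ⊆ VS src tgt sel′ r
      old v∈ with Old.VS⁻ v∈
      ... | inj₁ refl = New.root∈VS
      ... | inj₂ (j , t , inj₁ refl) = New.src∈VS j (sel⇒sel′ j t)
      ... | inj₂ (j , t , inj₂ refl) = New.tgt∈VS j (sel⇒sel′ j t)
      to : VS src tgt sel′ r ⊆ VS src tgt sel r ∪ ⁅ tgt i ⁆
      to v∈ with New.VS⁻ v∈
      ... | inj₁ refl = x∈p∪q⁺ (inj₁ Old.root∈VS)
      ... | inj₂ (j , t , e) with sel′⇒ j t | e
      ...   | inj₁ refl | inj₁ refl = x∈p∪q⁺ (inj₁ src∈)
      ...   | inj₁ refl | inj₂ refl = x∈p∪q⁺ (inj₂ (x∈⁅x⁆ (tgt i)))
      ...   | inj₂ t′   | inj₁ refl = x∈p∪q⁺ (inj₁ (Old.src∈VS j t′))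
      ...   | inj₂ t′   | inj₂ refl = x∈p∪q⁺ (inj₁ (Old.tgt∈VS j t′))

    Reach-mono : ∀ {v} → Reach src tgt sel r v → Reach src tgt sel′ r v
    Reach-mono here = here
    Reach-mono (step j t e reach) = step j (sel⇒sel′ j t) e (Reach-mono reach)

    indeg-other : ∀ v → v ≢ tgt i → indeg src tgt sel′ r v ≡ indeg src tgt sel r v
    indeg-other v v≢ = cnt-cong pointwise
      where
      pointwise : ∀ j → (sel′ j ∧ (tgt j == v)) ≡ (sel j ∧ (tgt j == v))
      pointwise j with j ≟ i
      ... | no j≢i = cong (_∧ (tgt j == v)) (same j j≢i)
      ... | yes refl = T-ext
        (λ t → ⊥-elim (v≢ (sym (T-==⁻ (proj₂ (T-∧⁻ {sel′ j} t))))))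
        (λ t → ⊥-elim (v≢ (sym (T-==⁻ (proj₂ (T-∧⁻ {sel j} t))))))

    -- The new arc hangs a leaf on the tree: one more arc, one more vertex, and no other in-degree
    -- changes.
    arborescence-extend : IsArborescence src tgt sel r → IsArborescence src tgt sel′ r
    arborescence-extend ((reach , size) , r-indeg , indeg-1) = (reach′ , size′) , r-indeg′ , indeg-1′
      where
      r≢ : r ≢ tgt i
      r≢ refl = tgt∉ Old.root∈VS
      reach′ : ∀ v → v ∈ VS src tgt sel′ r → Reach src tgt sel′ r v
      reach′ v v∈ with x∈p∪q⁻ (VS src tgt sel r) ⁅ tgt i ⁆ (subst (v ∈_) VS-extend v∈)
      ... | inj₁ v∈VS = Reach-mono (reach v v∈VS)
      ... | inj₂ v∈t with refl ← x∈⁅y⁆⇒x≡y (tgt i) v∈t = step i sel′-i (inj₁ (refl , refl)) (Reach-mono (reach (src i) src∈))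
      size′ : cnt sel′ + 1 ≡ ∣ VS src tgt sel′ r ∣
      size′ = trans (cong (_+ 1) (cnt-add sel sel′ i ¬sel-i sel′-i same))
        (trans (cong suc size) (trans (sym (∣∪⁅⁆∣ (tgt i) (VS src tgt sel r) tgt∉)) (cong ∣_∣ (sym VS-extend))))
      r-indeg′ : indeg src tgt sel′ r r ≡ 0
      r-indeg′ = trans (indeg-other r r≢) r-indeg
      indeg-1′ : ∀ v → v ∈ VS src tgt sel′ r → v ≢ r → indeg src tgt sel′ r v ≡ 1
      indeg-1′ v v∈ v≢r with v ≟ tgt i
      ... | yes refl = trans
        (cnt-add (λ j → sel j ∧ (tgt j == tgt i)) (λ j → sel′ j ∧ (tgt j == tgt i)) i
          (λ t → ¬sel-i (proj₁ (T-∧⁻ {sel i} t))) (T-∧⁺ sel′-i (T-==⁺ refl))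
          (λ j j≢i → cong (_∧ (tgt j == tgt i)) (same j j≢i)))
        -- An old arc ending at the new vertex would have put it into `VS` before.
        (cong suc (cnt≡0 λ j t → let a , b = T-∧⁻ {sel j} t in tgt∉ (subst (_∈ VS src tgt sel r) (T-==⁻ b) (Old.tgt∈VS j a))))
      ... | no v≢t with x∈p∪q⁻ (VS src tgt sel r) ⁅ tgt i ⁆ (subst (v ∈_) VS-extend v∈)
      ...   | inj₁ v∈VS = trans (indeg-other v v≢t) (indeg-1 v v∈VS v≢r)
      ...   | inj₂ v∈t = ⊥-elim (v≢t (x∈⁅y⁆⇒x≡y (tgt i) v∈t))

-- States of a growing packing.

ownedᵇ : Fin n → Maybe (Fin n) → Bool
ownedᵇ r (just s) = s == r
ownedᵇ r nothing  = false

freeᵇ : Maybe (Fin n) → Bool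
freeᵇ (just _) = false
freeᵇ nothing  = true

freeᵇ⁻ : {x : Maybe (Fin n)} → T (freeᵇ x) → x ≡ nothing
freeᵇ⁻ {x = nothing} _ = refl

update : {A : Set} → Fin m → A → (Fin m → A) → Fin m → A
update i x g j with j ≟ i
... | yes _ = x
... | no _  = g j

update-same : {A : Set} (i : Fin m) (x : A) (g : Fin m → A) → update i x g i ≡ x
update-same i x g with i ≟ i
... | yes _  = refl
... | no i≢i = ⊥-elim (i≢i refl)

update-other : {A : Set} (i : Fin m) (x : A) (g : Fin m → A) {j : Fin m} → j ≢ i → update i x g j ≡ g j
update-other i x g {j} j≢i with j ≟ i
... | yes j≡i = ⊥-elim (j≢i j≡i)
... | no _    = refl

iterate : {A : Set} (μ : A → ℕ) {Done : A → Set} → (∀ a → Done a ⊎ ∃ λ a′ → μ a′ < μ a) → A → ∃ Done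
iterate {A} μ {Done} next a = go (suc (μ a)) a ≤-refl
  where
  go : ∀ N a → μ a < N → ∃ Done
  go (suc N) a <N with next a
  ... | inj₁ done = a , done
  ... | inj₂ (a′ , lt) = go N a′ (<-≤-trans lt (≤-pred <N))

module Growing {n m : ℕ} {R : Subset n} (M : Matroid R) (tl : Fin m → Subset n) (hd : Fin m → Fin n) where
  open Matroid M
  open MatroidRank M
  open Arborescence

  selected : (Fin m → Maybe (Fin n)) → Fin n → Fin m → Bool
  selected own r i = ownedᵇ r (own i)

  rootsAt : (Fin m → Maybe (Fin n)) → (Fin m → Fin n) → Fin n → Subset n
  rootsAt own src v = tabulate λ r → (r ∈ᵇ R) ∧ (v ∈ᵇ VS src hd (selected own r) r)

  -- A packing under construction. The source of an edge is provisional until the edge is owned.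
  -- `indep` keeps the roots at each vertex independent, so that in the end only full rank has to be
  -- reached.
  record State : Set where
    field
      own   : Fin m → Maybe (Fin n)
      source : Fin m → Fin n
      source∈ : ∀ i → source i ∈ tl i
      own∈R : ∀ i r → own i ≡ just r → r ∈ R
      arb   : ∀ r → r ∈ R → IsArborescence source hd (selected own r) r
      indep : ∀ v → v ∉ R → ρ (rootsAt own source v) ≡ ∣ rootsAt own source v ∣

    P : Fin n → Subset n
    P = rootsAt own source

    free : Fin m → Bool
    free i = freeᵇ (own i)

    P⁺ : ∀ {r v} → r ∈ R → v ∈ VS source hd (selected own r) r → r ∈ P v
    P⁺ r∈R v∈ = ∈tabulate⁺ (T-∧⁺ (∈⇒T r∈R) (∈⇒T v∈))

    P⁻ : ∀ {r v} → r ∈ P v → r ∈ R × v ∈ VS source hd (selected own r) r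
    P⁻ {r} r∈ with a , b ← T-∧⁻ {r ∈ᵇ R} (∈tabulate⁻ r∈) = T⇒∈ a , T⇒∈ b

  open State

  record Step (S : State) (i : Fin m) (r : Fin n) : Set where
    field
      S′        : State
      own-same  : own S′ i ≡ just r
      own-other : ∀ {j} → j ≢ i → own S′ j ≡ own S j
      P-mono    : ∀ v → P S v ⊆ P S′ v
      P-new     : r ∈ P S′ (hd i)

    fewer : T (free S i) → cnt (free S′) < cnt (free S)
    fewer fr = ≤-reflexive (sym (cnt-add (free S′) (free S) i (subst (¬_ ∘ T ∘ freeᵇ) (sym own-same) id) fr
                 (λ j j≢i → cong freeᵇ (sym (own-other j≢i)))))

  -- `¬span` serves twice: `r` is not yet at the head, so the arc reaches a new vertex, and adding
  -- `r` there keeps the set independent.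
  module Extend (S : State) (i : Fin m) (u r : Fin n) (i-free : T (free S i)) (u∈tl : u ∈ tl i) (r∈Pu : r ∈ P S u)
                (hd∉R : hd i ∉ R) (¬span : ¬ InSpan r (P S (hd i))) where

    private
      own′ = update i (just r) (own S)
      src′ = update i u (source S)
      sel = selected (own S)
      sel′ = selected own′
      r∈R = proj₁ (P⁻ S r∈Pu)

    not-selected : ∀ s → ¬ T (sel s i)
    not-selected s t = subst (T ∘ ownedᵇ s) (freeᵇ⁻ i-free) t

    src-cong : ∀ s j → T (sel s j) → source S j ≡ src′ j × hd j ≡ hd j
    src-cong s j t = sym (update-other i u (source S) (λ { refl → not-selected s t })) , refl

    module Same (s : Fin n) = Congruence {src = source S} {src′ = src′} {tgt = hd} {tgt′ = hd} s (λ i → refl {x = sel s i}) (src-cong s)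

    r∉ : r ∉ P S (hd i)
    r∉ r∈ = ¬span (∈⇒inSpan r (P S (hd i)) r∈)

    selected-i : T (sel′ r i)
    selected-i = subst (T ∘ ownedᵇ r) (sym (update-same i (just r) (own S))) (T-==⁺ {u = r} refl)

    module Grow = Extension {src = src′} {tgt = hd} {sel = sel r} {sel′ = sel′ r} {r = r} i (not-selected r) selected-i
      (λ j j≢i → cong (ownedᵇ r) (update-other i (just r) (own S) j≢i))
      (subst₂ _∈_ (sym (update-same i u (source S))) (Same.VS-cong r) (proj₂ (P⁻ S r∈Pu)))
      (λ h∈ → r∉ (P⁺ S r∈R (subst (hd i ∈_) (sym (Same.VS-cong r)) h∈)))

    sel-other : ∀ s → s ≢ r → ∀ j → sel s j ≡ sel′ s j
    sel-other s s≢r j with j ≟ i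
    ... | no j≢i = refl
    ... | yes refl = T-ext (⊥-elim ∘ not-selected s) (λ t → ⊥-elim (s≢r (sym (T-==⁻ t))))

    module Other (s : Fin n) (s≢r : s ≢ r) =
      Congruence {src = source S} {src′ = src′} {tgt = hd} {tgt′ = hd} s (sel-other s s≢r) (src-cong s)

    VS-r : VS src′ hd (sel′ r) r ≡ VS (source S) hd (sel r) r ∪ ⁅ hd i ⁆
    VS-r = trans Grow.VS-extend (cong (_∪ ⁅ hd i ⁆) (sym (Same.VS-cong r)))

    P′ = rootsAt own′ src′

    P-same : ∀ v → v ≢ hd i → P′ v ≡ P S v
    P-same v v≢ = tabulate-cong λ s → cong ((s ∈ᵇ R) ∧_) (same s)
      where
      same : ∀ s → (v ∈ᵇ VS src′ hd (sel′ s) s) ≡ (v ∈ᵇ VS (source S) hd (sel s) s)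
      same s with s ≟ r
      ... | no s≢r = cong (v ∈ᵇ_) (sym (Other.VS-cong s s≢r))
      ... | yes refl = trans (cong (v ∈ᵇ_) VS-r) (T-ext
              (λ t → [ ∈⇒T , (λ v∈ → ⊥-elim (v≢ (x∈⁅y⁆⇒x≡y (hd i) v∈))) ] (x∈p∪q⁻ (VS (source S) hd (sel r) r) ⁅ hd i ⁆ (T⇒∈ t)))
              (λ t → ∈⇒T {X = VS (source S) hd (sel r) r ∪ ⁅ hd i ⁆} (p⊆p∪q ⁅ hd i ⁆ (T⇒∈ {X = VS (source S) hd (sel r) r} t))))

    P-hd : P′ (hd i) ≡ P S (hd i) ∪ ⁅ r ⁆
    P-hd = ⊆-antisym to (∪-⊆ from (⁅⁆⊆ (∈tabulate⁺ (T-∧⁺ (∈⇒T r∈R) (∈⇒T hd∈)))))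
      where
      hd∈ : hd i ∈ VS src′ hd (sel′ r) r
      hd∈ = subst (hd i ∈_) (sym VS-r) (q⊆p∪q (VS (source S) hd (sel r) r) ⁅ hd i ⁆ (x∈⁅x⁆ (hd i)))
      to : P′ (hd i) ⊆ P S (hd i) ∪ ⁅ r ⁆
      to {s} s∈ with s ≟ r
      ... | yes refl = x∈p∪q⁺ (inj₂ (x∈⁅x⁆ r))
      ... | no s≢r with a , b ← T-∧⁻ {s ∈ᵇ R} (∈tabulate⁻ s∈) =
        x∈p∪q⁺ (inj₁ (P⁺ S (T⇒∈ a) (subst (hd i ∈_) (sym (Other.VS-cong s s≢r)) (T⇒∈ b))))
      from : P S (hd i) ⊆ P′ (hd i)
      from {s} s∈ with s ≟ r
      ... | yes refl = ⊥-elim (r∉ s∈)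
      ... | no s≢r with a , b ← P⁻ S s∈ = ∈tabulate⁺ (T-∧⁺ (∈⇒T a) (∈⇒T (subst (hd i ∈_) (Other.VS-cong s s≢r) b)))

    extended : State
    extended .own = own′
    extended .source = src′
    extended .source∈ j with j ≟ i
    ... | yes refl = u∈tl
    ... | no _ = source∈ S j
    extended .own∈R j s eq with j ≟ i
    ... | yes refl = subst (_∈ R) (just-injective eq) r∈R
    ... | no _ = own∈R S j s eq
    extended .arb s s∈R with s ≟ r
    ... | yes refl = Grow.arborescence-extend (Same.arborescence-cong r (arb S r r∈R))
    ... | no s≢r = Other.arborescence-cong s s≢r (arb S s s∈R)
    extended .indep v v∉R with v ≟ hd i
    ... | no v≢ = trans (cong ρ (P-same v v≢)) (trans (indep S v v∉R) (cong ∣_∣ (sym (P-same v v≢))))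
    -- The size grows by one, and the unspanned `r` raises the rank by at least one.
    ... | yes refl = ≤-antisym (ρ≤∣∣ (P′ v)) (begin
        ∣ P′ v ∣             ≡⟨ cong ∣_∣ P-hd ⟩
        ∣ P S v ∪ ⁅ r ⁆ ∣    ≡⟨ ∣∪⁅⁆∣ r (P S v) r∉ ⟩
        suc ∣ P S v ∣        ≡⟨ cong suc (indep S v v∉R) ⟨
        suc (ρ (P S v))      ≤⟨ ≰⇒> ¬span ⟩
        ρ (P S v ∪ ⁅ r ⁆)    ≡⟨ cong ρ P-hd ⟨
        ρ (P′ v)             ∎)
      where open ≤-Reasoning

    extend : Step S i r
    extend = record
      { S′ = extended
      ; own-same = update-same i (just r) (own S)
      ; own-other = update-other i (just r) (own S)
      ; P-mono = mono
      ; P-new = subst (r ∈_) (sym P-hd) (q⊆p∪q (P S (hd i)) ⁅ r ⁆ (x∈⁅x⁆ r)) }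
      where
      mono : ∀ v → P S v ⊆ P′ v
      mono v {s} s∈ with v ≟ hd i
      ... | yes refl = subst (s ∈_) (sym P-hd) (p⊆p∪q ⁅ r ⁆ s∈)
      ... | no v≢ = subst (s ∈_) (sym (P-same v v≢)) s∈

  initial : (∀ i → Nonempty (tl i)) → State
  initial tl-ne .own i = nothing
  initial tl-ne .source i = proj₁ (tl-ne i)
  initial tl-ne .source∈ i = proj₂ (tl-ne i)
  initial tl-ne .own∈R i r ()
  initial tl-ne .arb r r∈R = Directed.single-arborescence _ hd (selected (λ _ → nothing) r) r (λ i ())
  initial tl-ne .indep v v∉R = trans (cong ρ none) (trans (n≤0⇒n≡0 (subst (ρ ⊥ ≤_) (∣⊥∣≡0 n) (ρ≤∣∣ ⊥))) (trans (sym (∣⊥∣≡0 n)) (cong ∣_∣ (sym none))))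
    where
    none : rootsAt (λ _ → nothing) (proj₁ ∘ tl-ne) v ≡ ⊥
    none = Empty-unique λ { (r , r∈) → let a , b = T-∧⁻ {r ∈ᵇ R} (∈tabulate⁻ r∈) in
      [ (λ { refl → v∉R (T⇒∈ a) }) , (λ ()) ] (Directed.VS⁻ (proj₁ ∘ tl-ne) hd (selected (λ _ → nothing) r) r (T⇒∈ b)) }

  -- Packing arborescences in the directed hypergraph.

  module Packs (hd∉R : ∀ i → hd i ∉ R) where
    open Orientation (∁ R) using (IsPart; isPart?; part-∪)
    open Step

    -- Only tail vertices outside `R` are counted as entering; a root in a tail acts through the
    -- sets `P` instead.
    inner : Fin m → Subset n
    inner i = tl i ∩ ∁ R

    UsedRoots : State → Set
    UsedRoots S = (∀ i r → r ∈ R → r ∈ tl i → own S i ≡ nothing ⊎ r ∈ P S (hd i)) ×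
                  (∀ i → T (free S i) ⊎ ∃ λ r → r ∈ R × tl i ≡ ⁅ r ⁆)

    used-step : ∀ {S i r} (st : Step S i r) → r ∈ R → tl i ≡ ⁅ r ⁆ → UsedRoots S → UsedRoots (S′ st)
    used-step {S} {i} {r} st r∈R tl≡ (used , only-roots) = used′ , only-roots′
      where
      used′ : ∀ j s → s ∈ R → s ∈ tl j → own (S′ st) j ≡ nothing ⊎ s ∈ P (S′ st) (hd j)
      used′ j s s∈R s∈tl with j ≟ i
      ... | yes refl = inj₂ (subst (_∈ P (S′ st) (hd i)) (sym (x∈⁅y⁆⇒x≡y r (subst (s ∈_) tl≡ s∈tl))) (P-new st))
      ... | no j≢i with used j s s∈R s∈tl
      ...   | inj₁ eq = inj₁ (trans (own-other st j≢i) eq)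
      ...   | inj₂ s∈P = inj₂ (P-mono st (hd j) s∈P)
      only-roots′ : ∀ j → T (free (S′ st) j) ⊎ ∃ λ s → s ∈ R × tl j ≡ ⁅ s ⁆
      only-roots′ j with j ≟ i
      ... | yes refl = inj₂ (r , r∈R , tl≡)
      ... | no j≢i with only-roots j
      ...   | inj₁ t = inj₁ (subst (T ∘ freeᵇ) (sym (own-other st j≢i)) t)
      ...   | inj₂ root = inj₂ root

    -- At the end a free edge from a root `r` has a head that spans `r`, by termination, and an
    -- assigned one has put `r` into `P` there. Edges with a tail vertex outside `R` stay free, as
    -- only edges with a single root for tail get assigned.
    root-phase : (∀ i r → r ∈ R → r ∈ tl i → tl i ≡ ⁅ r ⁆) → (∀ i → Nonempty (tl i)) →
                 ∃ λ S → (∀ i r → r ∈ R → r ∈ tl i → InSpan r (P S (hd i))) × (∀ i → Nonempty (inner i) → T (free S i))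
    root-phase tl-root tl-ne = result (iterate (λ (S , _) → cnt (free S)) {Done} next (initial tl-ne , (λ i r _ _ → inj₁ refl) , λ i → inj₁ tt))
      where
      Done : Σ State UsedRoots → Set
      Done (S , _) = ∀ i r → r ∈ R → r ∈ tl i → InSpan r (P S (hd i))
      next : (a : Σ State UsedRoots) → Done a ⊎ ∃ λ a′ → cnt (free (proj₁ a′)) < cnt (free (proj₁ a))
      next (S , inv) with any? (λ i → any? (λ r → T? (free S i) ×-dec (r ∈? R) ×-dec (r ∈? tl i) ×-dec ¬? (inSpan? r (P S (hd i)))))
      ... | no none = inj₁ done
        where
        done : Done (S , inv)
        done i r r∈R r∈tl with proj₁ inv i r r∈R r∈tl
        ... | inj₂ r∈P = ∈⇒inSpan r (P S (hd i)) r∈P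
        ... | inj₁ eq = decidable-stable (inSpan? r (P S (hd i))) λ ¬span → none (i , r , subst (T ∘ freeᵇ) (sym eq) tt , r∈R , r∈tl , ¬span)
      ... | yes (i , r , i-free , r∈R , r∈tl , ¬span) = inj₂ ((S′ st , used-step st r∈R (tl-root i r r∈R r∈tl) inv) , fewer st i-free)
        where
        st : Step S i r
        st = Extend.extend S i r r i-free r∈tl (P⁺ S r∈R (Directed.root∈VS (source S) hd (selected (own S) r) r)) (hd∉R i) ¬span
      result : ∃ Done → ∃ λ S → (∀ i r → r ∈ R → r ∈ tl i → InSpan r (P S (hd i))) × (∀ i → Nonempty (inner i) → T (free S i))
      result ((S , _ , only-roots) , done) = S , done , unused
        where
        unused : ∀ i → Nonempty (inner i) → T (free S i)
        unused i (w , w∈) with only-roots i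
        ... | inj₁ t = t
        ... | inj₂ (r , r∈R , tl≡) = ⊥-elim (x∈∁p⇒x∉p (p∩q⊆q (tl i) (∁ R) w∈)
          (subst (_∈ R) (sym (x∈⁅y⁆⇒x≡y r (subst (w ∈_) tl≡ (p∩q⊆p (tl i) (∁ R) w∈)))) r∈R))

    module Ent (S : State) = Entering (free S) inner hd

    Covered : State → Set
    Covered S = ∀ X → IsPart X → rank R ≤ Ent.d S X + f (P S) X

    -- Such an edge does not enter `X`. Its tail lies in `X` but not in an obstructing set, which
    -- makes the intersection of the two smaller than `X`.
    record Good (S : State) (X : Subset n) : Set where
      constructor good
      field
        {i}      : Fin m
        {u r}    : Fin n
        i-free   : T (free S i)
        hd∈      : hd i ∈ X
        tl⊆      : inner i ⊆ X
        u∈       : u ∈ inner i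
        r∈       : r ∈ P S u
        ¬span    : ¬ InSpan r (P S (hd i))

    IsTight : State → Subset n → Set
    IsTight S X = Ent.d S X + f (P S) X ≤ rank R

    tight⇒good : ∀ S → Covered S → ∀ X → IsPart X → IsTight S X → ∀ v → v ∈ X → ρ (P S v) < f (P S) X → Good S X
    tight⇒good S covered X X-part X-tight v v∈X v<X =
      good {i = j} j-free (Z⊆X hd∈Z) tl⊆X w∈ (proj₁ (proj₂ escapes)) ¬span′
      where
      open ≤-Reasoning
      Pv = P S v
      below? : ∀ w → Dec (ρ (Pv ∪ P S w) ≤ ρ Pv)
      below? w = ρ (Pv ∪ P S w) ≤? ρ Pv
      -- `Z` collects the vertices of `X` whose roots are spanned by those at `v`; it contains `v`.
      Z : Subset n
      Z = tabulate λ w → (w ∈ᵇ X) ∧ ⌊ below? w ⌋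
      Z⁻ : ∀ {w} → w ∈ Z → w ∈ X × ρ (Pv ∪ P S w) ≤ ρ Pv
      Z⁻ {w} w∈ with a , b ← T-∧⁻ {w ∈ᵇ X} (∈tabulate⁻ w∈) = T⇒∈ a , toWitness b
      Z⁺ : ∀ {w} → w ∈ X → ρ (Pv ∪ P S w) ≤ ρ Pv → w ∈ Z
      Z⁺ w∈X le = ∈tabulate⁺ (T-∧⁺ (∈⇒T w∈X) (fromWitness le))
      Z⊆X : Z ⊆ X
      Z⊆X w∈ = proj₁ (Z⁻ w∈)
      fZ≤ : f (P S) Z ≤ ρ Pv
      fZ≤ = ≤-trans (ρ-mono (image (P S) Z) (Pv ∪ image (P S) Z) (q⊆p∪q Pv _)) (span-rank Pv (image (P S) Z) λ r r∈ →
        let w , w∈Z , r∈w = image⁻ (P S) r∈ in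
        ≤-trans (ρ-mono (Pv ∪ ⁅ r ⁆) (Pv ∪ P S w) (∪-mono id (⁅⁆⊆ r∈w))) (proj₂ (Z⁻ w∈Z)))
      -- `X` is tight and `Z` is covered, but `f` is smaller on `Z`, so more edges enter `Z` than
      -- `X`.
      dX<dZ : Ent.d S X < Ent.d S Z
      dX<dZ = +-cancelʳ-< (f (P S) X) _ _ (begin-strict
        Ent.d S X + f (P S) X  ≤⟨ X-tight ⟩
        rank R                 ≤⟨ covered Z ((v , Z⁺ v∈X (ρ-mono (Pv ∪ Pv) Pv (∪-⊆ id id))) , ⊆-trans Z⊆X (proj₂ X-part)) ⟩
        Ent.d S Z + f (P S) Z  ≤⟨ +-monoʳ-≤ (Ent.d S Z) fZ≤ ⟩
        Ent.d S Z + ρ Pv       <⟨ +-monoʳ-< (Ent.d S Z) v<X ⟩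
        Ent.d S Z + f (P S) X  ∎)
      new-edge : ∃ λ i → T (Ent.entᵇ S i Z) × ¬ T (Ent.entᵇ S i X)
      new-edge = cnt-<⇒∃ (λ i → Ent.entᵇ S i X) (λ i → Ent.entᵇ S i Z) dX<dZ
      j = proj₁ new-edge
      entZ : T (free S j) × hd j ∈ Z × ∃ λ w → w ∈ inner j × w ∉ Z
      entZ = Ent.ent⁻ S {j} {Z} (proj₁ (proj₂ new-edge))
      j-free = proj₁ entZ
      hd∈Z = proj₁ (proj₂ entZ)
      w = proj₁ (proj₂ (proj₂ entZ))
      w∈ = proj₁ (proj₂ (proj₂ (proj₂ entZ)))
      w∉Z = proj₂ (proj₂ (proj₂ (proj₂ entZ)))
      -- The edge enters `Z` but not `X`, and its head lies in `X`; so does its inner tail.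
      tl⊆X : inner j ⊆ X
      tl⊆X {x} x∈ = decidable-stable (x ∈? X) λ x∉X → proj₂ (proj₂ new-edge) (Ent.ent⁺ S j-free (Z⊆X hd∈Z) x∈ x∉X)
      escapes : ∃ λ r → r ∈ P S w × ¬ InSpan r Pv
      escapes = decidable-stable (any? λ r → (r ∈? P S w) ×-dec ¬? (inSpan? r Pv)) λ none →
        w∉Z (Z⁺ (tl⊆X w∈) (span-rank Pv (P S w) λ r r∈ → decidable-stable (inSpan? r Pv) λ ¬span → none (r , r∈ , ¬span)))
      r = proj₁ escapes
      -- The head is in `Z`, so whatever is spanned there is spanned by `Pv`.
      ¬span′ : ¬ InSpan r (P S (hd j))
      ¬span′ sp = proj₂ (proj₂ escapes) (begin
        ρ (Pv ∪ ⁅ r ⁆)                    ≤⟨ ρ-mono _ _ (∪-mono (p⊆p∪q (P S (hd j))) id) ⟩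
        ρ ((Pv ∪ P S (hd j)) ∪ ⁅ r ⁆)     ≤⟨ inSpan-mono r _ _ (q⊆p∪q Pv (P S (hd j))) sp ⟩
        ρ (Pv ∪ P S (hd j))               ≤⟨ proj₂ (Z⁻ hd∈Z) ⟩
        ρ Pv                              ∎)

    Progress : State → Set
    Progress S = ∃ λ S⁺ → Covered S⁺ × cnt (free S⁺) < cnt (free S)

    -- A tight set that would become uncovered if i were assigned to r.
    Obstructs : State → Fin m → Fin n → Subset n → Set
    Obstructs S i r Y = IsPart Y × hd i ∈ Y × ¬ (inner i ⊆ Y) × IsTight S Y × InSpan r (image (P S) Y)

    obstructs? : ∀ S i r Y → Dec (Obstructs S i r Y)
    obstructs? S i r Y = isPart? Y ×-dec (hd i ∈? Y) ×-dec ¬? (inner i ⊆? Y) ×-dec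
      (Ent.d S Y + f (P S) Y ≤? rank R) ×-dec inSpan? r (image (P S) Y)

    -- The assignment can hurt only sets that `i` enters, each by one. If such a set does not span
    -- `r`, its gain in rank makes up for the loss; if it does, it is not tight, since it would
    -- obstruct, and has one to spare.
    step-covered : ∀ {S i r} (st : Step S i r) → T (free S i) → Covered S → (∀ Y → ¬ Obstructs S i r Y) → Covered (S′ st)
    step-covered {S} {i} {r} st i-free covered unobstructed Y Y-part with T? (Ent.entᵇ S i Y)
    ... | no ¬ent = ≤-trans (covered Y Y-part) (+-mono-≤ (cnt-mono kept) f≤)
      where
      f≤ : f (P S) Y ≤ f (P (S′ st)) Y
      f≤ = ρ-mono _ _ λ s∈ → let v , v∈ , s∈P = image⁻ (P S) {Y} s∈ in image⁺ (P (S′ st)) {Y} v∈ (P-mono st v s∈P)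
      kept : ∀ j → T (Ent.entᵇ S j Y) → T (Ent.entᵇ (S′ st) j Y)
      kept j t with j ≟ i
      ... | yes refl = ⊥-elim (¬ent t)
      ... | no j≢i = subst (λ o → T (freeᵇ o ∧ ((hd j ∈ᵇ Y) ∧ nonemptyᵇ (inner j ─ Y)))) (sym (own-other st j≢i)) t
    ... | yes ent with _ , hd∈Y , w , w∈ , w∉Y ← Ent.ent⁻ S {i} {Y} ent = covered′
      where
      open ≤-Reasoning
      d≡ : Ent.d S Y ≡ suc (Ent.d (S′ st) Y)
      d≡ = cnt-add (λ j → Ent.entᵇ (S′ st) j Y) (λ j → Ent.entᵇ S j Y) i
        (λ t → subst (T ∘ freeᵇ) (own-same st) (proj₁ (Ent.ent⁻ (S′ st) {i} {Y} t))) ent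
        (λ j j≢i → cong (λ o → freeᵇ o ∧ ((hd j ∈ᵇ Y) ∧ nonemptyᵇ (inner j ─ Y))) (sym (own-other st j≢i)))
      f≤ : ρ (image (P S) Y ∪ ⁅ r ⁆) ≤ f (P (S′ st)) Y
      f≤ = ρ-mono _ _ (∪-⊆ (λ s∈ → let v , v∈ , s∈P = image⁻ (P S) {Y} s∈ in image⁺ (P (S′ st)) {Y} v∈ (P-mono st v s∈P))
                           (⁅⁆⊆ (image⁺ (P (S′ st)) hd∈Y (P-new st))))
      covered′ : rank R ≤ Ent.d (S′ st) Y + f (P (S′ st)) Y
      covered′ with inSpan? r (image (P S) Y)
      ... | yes sp = ≤-pred (begin-strict
        rank R                                   <⟨ ≰⇒> (λ Y-tight → unobstructed Y (Y-part , hd∈Y , (λ ⊆Y → w∉Y (⊆Y w∈)) , Y-tight , sp)) ⟩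
        Ent.d S Y + f (P S) Y                    ≡⟨ cong (_+ f (P S) Y) d≡ ⟩
        suc (Ent.d (S′ st) Y) + f (P S) Y        ≤⟨ +-monoʳ-≤ (suc (Ent.d (S′ st) Y)) (≤-trans (ρ-mono _ _ (p⊆p∪q ⁅ r ⁆)) f≤) ⟩
        suc (Ent.d (S′ st) Y + f (P (S′ st)) Y)  ∎)
      ... | no ¬sp = begin
        rank R                                   ≤⟨ covered Y Y-part ⟩
        Ent.d S Y + f (P S) Y                    ≡⟨ cong (_+ f (P S) Y) d≡ ⟩
        suc (Ent.d (S′ st) Y + f (P S) Y)        ≡⟨ +-suc _ _ ⟨
        Ent.d (S′ st) Y + suc (f (P S) Y)        ≤⟨ +-monoʳ-≤ (Ent.d (S′ st) Y) (≤-trans (≰⇒> ¬sp) f≤) ⟩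
        Ent.d (S′ st) Y + f (P (S′ st)) Y        ∎

    module _ (S : State) (covered : Covered S) where
      private
        d = Ent.d S
        fS = f (P S)

      -- Submodularity bounds the values at `X ∪ Y` and `X ∩ Y` by twice the rank in total, while
      -- both sets are covered, so equality holds throughout. The second component is the resulting
      -- modularity of `f` on this pair.
      tight-∩ : ∀ X Y → IsPart X → IsPart Y → Nonempty (X ∩ Y) → IsTight S X → IsTight S Y →
                IsTight S (X ∩ Y) × fS X + fS Y ≤ fS (X ∪ Y) + fS (X ∩ Y)
      tight-∩ X Y X-part Y-part X∩Y X-tight Y-tight =
        +-cancelˡ-≤ (rank R) _ _ (≤-trans (+-monoˡ-≤ (d (X ∩ Y) + fS (X ∩ Y)) (covered (X ∪ Y) (part-∪ X-part Y-part)))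
          (≤-trans (≤-reflexive (+-interchange (d (X ∪ Y)) _ _ _)) (≤-trans (+-mono-≤ (Ent.d-submod S X Y) (f-submod (P S) X Y)) total))) ,
        +-cancelˡ-≤ (d X + d Y) _ _ (≤-trans total
          (≤-trans (+-mono-≤ (covered (X ∪ Y) (part-∪ X-part Y-part)) (covered (X ∩ Y) (X∩Y , ⊆-trans (p∩q⊆p X Y) (proj₂ X-part))))
          (≤-trans (≤-reflexive (+-interchange (d (X ∪ Y)) _ _ _)) (+-monoˡ-≤ _ (Ent.d-submod S X Y)))))
        where
        total : (d X + d Y) + (fS X + fS Y) ≤ rank R + rank R
        total = ≤-trans (≤-reflexive (+-interchange (d X) _ _ _)) (+-mono-≤ X-tight Y-tight)

      -- Induction on the size of `X`: either nothing obstructs the assignment, or an obstructing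
      -- `Y` yields the smaller tight set `X ∩ Y` with a good edge of its own.
      good⇒progress : ∀ N X → ∣ X ∣ ≤ N → IsPart X → IsTight S X → Good S X → Progress S
      good⇒progress N X ∣X∣≤N X-part X-tight (good {i} {u} {r} i-free hd∈X tl⊆X u∈ r∈u ¬span)
        with anySubset? (obstructs? S i r)
      ... | no none = S′ st , step-covered st i-free covered (λ Y ob → none (Y , ob)) , fewer st i-free
        where
        st : Step S i r
        st = Extend.extend S i u r i-free (p∩q⊆p (tl i) (∁ R) u∈) r∈u (hd∉R i) ¬span
      ... | yes (Y , Y-part , hd∈Y , tl⊈Y , Y-tight , sp) = smaller N ∣X∣≤N
        where
        open ≤-Reasoning
        hd∈XY : hd i ∈ X ∩ Y
        hd∈XY = x∈p∩q⁺ (hd∈X , hd∈Y)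
        XY-part : IsPart (X ∩ Y)
        XY-part = (hd i , hd∈XY) , ⊆-trans (p∩q⊆p X Y) (proj₂ X-part)
        XY-tight = tight-∩ X Y X-part Y-part (hd i , hd∈XY) X-tight Y-tight
        imX = image (P S) X
        imY = image (P S) Y
        imXY = image (P S) (X ∩ Y)
        -- `r` is among the roots of `X`, by way of `u`, and is spanned by those of `Y`. As `f` is
        -- modular on this pair, the roots of `X ∩ Y` span it already.
        span-XY : InSpan r imXY
        span-XY = +-cancelˡ-≤ (fS (X ∪ Y)) _ _ (begin
          fS (X ∪ Y) + ρ (imXY ∪ ⁅ r ⁆)   ≤⟨ ρ-submod imX (imY ∪ ⁅ r ⁆)
                                               (λ s∈ → ∪-mono id (p⊆p∪q ⁅ r ⁆) (image-∪ (P S) X Y s∈))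
                                               (∪-⊆ (λ s∈ → let a , b = x∈p∩q⁻ imX imY (image-∩ (P S) X Y s∈) in x∈p∩q⁺ (a , p⊆p∪q ⁅ r ⁆ b))
                                                    (⁅⁆⊆ (x∈p∩q⁺ (image⁺ (P S) (tl⊆X u∈) r∈u , q⊆p∪q imY ⁅ r ⁆ (x∈⁅x⁆ r))))) ⟩
          fS X + ρ (imY ∪ ⁅ r ⁆)          ≤⟨ +-monoʳ-≤ (fS X) sp ⟩
          fS X + fS Y                     ≤⟨ proj₂ XY-tight ⟩
          fS (X ∪ Y) + fS (X ∩ Y)         ∎)
        -- Otherwise the roots at `hd i` would span those of `X ∩ Y`, and hence `r`.
        hd<XY : ρ (P S (hd i)) < fS (X ∩ Y)
        hd<XY = ≰⇒> λ le → ¬span (begin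
          ρ (P S (hd i) ∪ ⁅ r ⁆)  ≤⟨ ρ-mono _ _ (∪-mono (image⁺ (P S) hd∈XY) id) ⟩
          ρ (imXY ∪ ⁅ r ⁆)        ≤⟨ span-XY ⟩
          ρ imXY                  ≤⟨ le ⟩
          ρ (P S (hd i))          ∎)
        shrunk : ∣ X ∩ Y ∣ < ∣ X ∣
        shrunk with x , x∈tl , x∉Y ← ⊈⇒∃ tl⊈Y = p⊂q⇒∣p∣<∣q∣ {p = X ∩ Y} {X} (p∩q⊆p X Y , x , tl⊆X x∈tl , x∉Y ∘ p∩q⊆q X Y)
        smaller : ∀ N → ∣ X ∣ ≤ N → Progress S
        smaller zero    ≤N = ⊥-elim (n≮0 (<-≤-trans shrunk ≤N))
        smaller (suc N) ≤N = good⇒progress N (X ∩ Y) (≤-pred (<-≤-trans shrunk ≤N)) XY-part (proj₁ XY-tight)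
          (tight⇒good S covered (X ∩ Y) XY-part (proj₁ XY-tight) (hd i) hd∈XY hd<XY)

      -- No edge enters `∁ R`, which contains all inner tails. So `∁ R` is tight and its roots have
      -- full rank, more than those at `v`.
      deficient⇒progress : ∀ v → v ∉ R → ρ (P S v) < rank R → Progress S
      deficient⇒progress v v∉R v< = good⇒progress ∣ ∁ R ∣ (∁ R) ≤-refl V-part V-tight
        (tight⇒good S covered (∁ R) V-part V-tight v v∈V (<-≤-trans v< (≤-trans (covered (∁ R) V-part) (≤-reflexive (cong (_+ fS (∁ R)) dV≡0)))))
        where
        v∈V : v ∈ ∁ R
        v∈V = x∉p⇒x∈∁p v∉R
        V-part : IsPart (∁ R)
        V-part = (v , v∈V) , id
        dV≡0 : d (∁ R) ≡ 0
        dV≡0 = cnt≡0 λ i t → let _ , _ , w , w∈ , w∉ = Ent.ent⁻ S {i} {∁ R} t in w∉ (p∩q⊆q (tl i) (∁ R) w∈)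
        V-tight : IsTight S (∁ R)
        V-tight = ≤-trans (≤-reflexive (cong (_+ fS (∁ R)) dV≡0)) (ρ≤rankR (image (P S) (∁ R)))

    complete : ∀ S → Covered S → ∃ λ S⁺ → ∀ v → v ∉ R → rank R ≤ ρ (P S⁺ v)
    complete S covered = result (iterate (λ (S , _) → cnt (free S)) {Done} next (S , covered))
      where
      Done : Σ State Covered → Set
      Done (S , _) = ∀ v → v ∉ R → rank R ≤ ρ (P S v)
      next : (a : Σ State Covered) → Done a ⊎ ∃ λ a′ → cnt (free (proj₁ a′)) < cnt (free (proj₁ a))
      next (S , covered) with any? (λ v → ¬? (v ∈? R) ×-dec (ρ (P S v) <? rank R))
      ... | no none = inj₁ λ v v∉R → ≮⇒≥ λ lt → none (v , v∉R , lt)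
      ... | yes (v , v∉R , lt) = inj₂ (advance (deficient⇒progress S covered v v∉R lt))
        where
        advance : Progress S → ∃ λ (a : Σ State Covered) → cnt (free (proj₁ a)) < cnt (free S)
        advance (S⁺ , covered⁺ , lt⁺) = (S⁺ , covered⁺) , lt⁺
      result : ∃ Done → ∃ λ S⁺ → ∀ v → v ∉ R → rank R ≤ ρ (P S⁺ v)
      result ((S⁺ , _) , done) = S⁺ , done

-- Counts over joined index sets and over disjoint classes.

cnt-↑ : ∀ a {b} (p : Fin (a + b) → Bool) → cnt p ≡ cnt (λ i → p (i ↑ˡ b)) + cnt (λ j → p (a ↑ʳ j))
cnt-↑ zero    p = refl
cnt-↑ (suc a) {b} p = trans (cnt-suc p) (trans (cong (bit (p zero) +_) (cnt-↑ a (p ∘ suc)))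
  (trans (sym (+-assoc (bit (p zero)) _ _)) (cong (_+ cnt (λ j → p (suc a ↑ʳ j))) (sym (cnt-suc (λ i → p (i ↑ˡ b)))))))

Σ-cnt-disjoint : ∀ {k ℓ} (q : Fin ℓ → Fin k → Bool) (t : Fin k → Bool) → (∀ i e → T (q i e) → T (t e)) →
                 (∀ e i j → T (q i e) → T (q j e) → i ≡ j) → Σ[ (λ i → cnt (q i)) ] ≤ cnt t
Σ-cnt-disjoint {ℓ = zero}  q t _ _ = z≤n
Σ-cnt-disjoint {k} {suc ℓ} q t q⇒t disj = begin
  -- The remaining classes avoid the first one, so they are counted within `t` minus `q zero`.
  cnt (q zero) + Σ[ (λ i → cnt (q (suc i))) ]          ≤⟨ +-monoʳ-≤ (cnt (q zero)) (Σ-cnt-disjoint (q ∘ suc) (λ e → t e ∧ not (q zero e))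
                                                            (λ i e qe → T-∧⁺ (q⇒t (suc i) e qe) (T-not⁺ λ q₀ → 0≢suc (disj e zero (suc i) q₀ qe)))
                                                            (λ e i j qi qj → suc-injective (disj e (suc i) (suc j) qi qj))) ⟩
  cnt (q zero) + cnt (λ e → t e ∧ not (q zero e))      ≤⟨ cnt-+≤+ {p = q zero} {λ e → t e ∧ not (q zero e)} {t} {λ _ → false} pointwise ⟩
  cnt t + cnt (λ (_ : Fin k) → false)                  ≡⟨ cong (cnt t +_) (cnt≡0 {p = λ (_ : Fin k) → false} (λ _ ())) ⟩
  cnt t + 0                                            ≡⟨ +-identityʳ (cnt t) ⟩
  cnt t                                                ∎
  where
  open ≤-Reasoning
  0≢suc : ∀ {i : Fin ℓ} → zero ≢ suc i
  0≢suc ()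
  pointwise : ∀ e → bit (q zero e) + bit (t e ∧ not (q zero e)) ≤ bit (t e) + 0
  pointwise e with q zero e | t e | q⇒t zero e
  ... | true  | true  | _ = ≤-refl
  ... | true  | false | h = ⊥-elim (h tt)
  ... | false | true  | _ = ≤-refl
  ... | false | false | _ = z≤n

-- Edges at the roots of a mixed hypergraph.

module Rooted {n : ℕ} (H : MixedHypergraph n) (R : Subset n) (roots : ∀ r → r ∈ R → IsRoot H r) where
  open MixedHypergraph H

  head∉R : ∀ a → head a ∉ R
  head∉R a h∈R with w , w∈ ← tail-nonempty a = proj₁ (roots (head a) h∈R) a
    (T-∧⁺ (∈⇒T (x∈⁅x⁆ (head a))) (T-nonempty⁺ (w , x∈p∧x∉q⇒x∈p─q w∈ (λ w∈h → head∉tail a (subst (_∈ tail a) (x∈⁅y⁆⇒x≡y (head a) w∈h) w∈)))))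

  tail-root : ∀ a r → r ∈ R → r ∈ tail a → tail a ≡ ⁅ r ⁆
  tail-root a r r∈R r∈tail = proj₂ (proj₂ (roots r r∈R)) a
    (T-∧⁺ (∈⇒T (x∉p⇒x∈∁p (λ h∈r → head∉R a (subst (_∈ R) (sym (x∈⁅y⁆⇒x≡y r h∈r)) r∈R))))
          (T-nonempty⁺ (r , x∈p∧x∉q⇒x∈p─q r∈tail (λ r∈∁ → x∈∁p⇒x∉p r∈∁ (x∈⁅x⁆ r)))))

  hedge-other : ∀ e v → ∃ λ w → w ∈ hedge e × w ≢ v
  hedge-other e v with ⊈⇒∃ {X = hedge e} {⁅ v ⁆} (λ sub → <⇒≱ (hedge-size e) (≤-trans (card-mono (hedge e) ⁅ v ⁆ sub) (≤-reflexive (∣⁅x⁆∣≡1 v))))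
  ... | w , w∈ , w∉ = w , w∈ , λ { refl → w∉ (x∈⁅x⁆ w) }

  hedge∌root : ∀ e r → r ∈ R → r ∉ hedge e
  hedge∌root e r r∈R r∈e with w , w∈ , w≢r ← hedge-other e r = proj₁ (proj₂ (roots r r∈R)) e
    (T-∧⁺ (T-nonempty⁺ (r , x∈p∩q⁺ (r∈e , x∈⁅x⁆ r)))
          (T-nonempty⁺ (w , x∈p∩q⁺ (w∈ , x∉p⇒x∈∁p (λ w∈r → w≢r (x∈⁅y⁆⇒x≡y r w∈r))))))

  entersE⁺ : ∀ {e X u v} → u ∈ hedge e → u ∈ X → v ∈ hedge e → v ∉ X → T (entersEᵇ H e X)
  entersE⁺ u∈e u∈X v∈e v∉X = T-∧⁺ (T-nonempty⁺ (_ , x∈p∩q⁺ (u∈e , u∈X))) (T-nonempty⁺ (_ , x∈p∩q⁺ (v∈e , x∉p⇒x∈∁p v∉X)))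

  entersE⁻ : ∀ {e X} → T (entersEᵇ H e X) → (∃ λ u → u ∈ hedge e × u ∈ X) × (∃ λ v → v ∈ hedge e × v ∉ X)
  entersE⁻ {e} {X} t with a , b ← T-∧⁻ {nonemptyᵇ (hedge e ∩ X)} t
    with u , u∈ ← T-nonempty⁻ {X = hedge e ∩ X} a | v , v∈ ← T-nonempty⁻ {X = hedge e ∩ ∁ X} b
    with u∈e , u∈X ← x∈p∩q⁻ (hedge e) X u∈ | v∈e , v∈∁X ← x∈p∩q⁻ (hedge e) (∁ X) v∈ =
    (u , u∈e , u∈X) , (v , v∈e , x∈∁p⇒x∉p v∈∁X)

  -- Necessity of the condition.

  module Necessity (M : Matroid R) (packing : Packing H R M) where
    open Matroid M
    open MatroidRank M
    open Arborescence
    open Packing packing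
    open Trimming trim

    private
      s = src H R M trim
      t = tgt H R M trim
      sel = selR H R M trim

    tgt∉R : ∀ i → t i ∉ R
    tgt∉R i with splitAt na i
    ... | inj₁ a = head∉R a
    ... | inj₂ e = λ hv∈R → hedge∌root e (hv e) hv∈R (hv∈ e)

    owner⁻ : ∀ r x → T (isOwn H R M trim r x) → x ≡ just r
    owner⁻ r (just s) eq = cong just (T-==⁻ eq)

    -- No arc has its head in `R`, so a directed path that ends there is empty.
    reached-root : ∀ {r v} → Directed.DReach s t (sel r) r v → v ∈ R → v ≡ r
    reached-root Directed.here _ = refl
    reached-root (Directed.step i _ _) v∈R = ⊥-elim (tgt∉R i v∈R)

    crossᵇ : Subset n → Subset n → Fin (na + nh) → Bool
    crossᵇ XO XI i = [ (λ a → entersBᵇ H a XO XI) , (λ e → (hv e ∈ᵇ XI) ∧ not (hu e ∈ᵇ XI)) ] (splitAt na i)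

    -- For a dyperedge, `tl a` is a tail vertex outside `XO`: otherwise it would lie in the wall,
    -- hence in `R`, and equal `r`, which the wall does not contain.
    crossing⇒crossᵇ : ∀ {XO XI r} → XO ─ XI ⊆ R → r ∉ XO ─ XI → ∀ i → (s i ∈ R → s i ≡ r) → s i ∉ XI → t i ∈ XI → T (crossᵇ XO XI i)
    crossing⇒crossᵇ {XO} {XI} {r} wall⊆R r∉wall i s-root s∉ t∈ with splitAt na i
    ... | inj₁ a = T-∧⁺ (∈⇒T t∈) (T-nonempty⁺ (tl a , x∈p∧x∉q⇒x∈p─q (tl∈ a) λ tl∈XO →
            let tl∈wall = x∈p∧x∉q⇒x∈p─q tl∈XO s∉ in r∉wall (subst (_∈ XO ─ XI) (s-root (wall⊆R tl∈wall)) tl∈wall)))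
    ... | inj₂ e = T-∧⁺ (∈⇒T t∈) (T-not⁺ (λ hu∈XI → s∉ (T⇒∈ hu∈XI)))

    -- Take the basis at a vertex `v` of `XI`. The wall accounts for at most its own rank, and each
    -- basis root outside the wall owns a crossing edge on its path to `v`.
    demand≤cross : ∀ XO XI → Nonempty XI → XI ⊆ ∁ R → XO ─ XI ⊆ R → rank R ∸ rank (XO ─ XI) ≤ cnt (crossᵇ XO XI)
    demand≤cross XO XI (v , v∈XI) XI⊆V wall⊆R = m≤n+o⇒m∸n≤o (rank R) (rank wall) (begin
      rank R                         ≡⟨ proj₂ B-basis ⟨
      ∣ B ∣                          ≡⟨ proj₂ (proj₁ B-basis) ⟨
      rank B                         ≡⟨ ρ≡rank B (proj₁ (proj₁ B-basis)) ⟨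
      ρ B                            ≤⟨ ρ-mono B (wall ∪ (B ─ wall)) B⊆ ⟩
      ρ (wall ∪ (B ─ wall))          ≤⟨ ρ-∪≤ wall (B ─ wall) ⟩
      ρ wall + ∣ B ─ wall ∣          ≡⟨ cong (_+ ∣ B ─ wall ∣) (ρ≡rank wall wall⊆R) ⟩
      rank wall + ∣ B ─ wall ∣       ≤⟨ +-monoʳ-≤ (rank wall) (card≤cnt (B ─ wall) (crossᵇ XO XI) (owner H R M trim) crossing) ⟩
      rank wall + cnt (crossᵇ XO XI) ∎)
      where
      open ≤-Reasoning
      wall = XO ─ XI
      B : Subset n
      B = tabulate λ r → (r ∈ᵇ R) ∧ (v ∈ᵇ VB H R M trim r)
      B-basis : IsBasis M B
      B-basis = basis v (x∈∁p⇒x∉p (XI⊆V v∈XI))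
      B⊆ : B ⊆ wall ∪ (B ─ wall)
      B⊆ {r} r∈ with r ∈? wall
      ... | yes r∈wall = x∈p∪q⁺ (inj₁ r∈wall)
      ... | no r∉wall = x∈p∪q⁺ (inj₂ (x∈p∧x∉q⇒x∈p─q r∈ r∉wall))
      crossing : ∀ r → r ∈ B ─ wall → ∃ λ i → T (crossᵇ XO XI i) × owner H R M trim i ≡ just r
      crossing r r∈ with r∈B , r∉wall ← ∈─⁻ {X = B} {wall} r∈ with a , b ← T-∧⁻ {r ∈ᵇ R} (∈tabulate⁻ r∈B)
        with i , i-sel , reach , s∉ , t∈ ← Directed.entering-arc s t (sel r) r (λ r∈XI → x∈∁p⇒x∉p (XI⊆V r∈XI) (T⇒∈ a)) v∈XI
          (Directed.Reach⇒DReach s t (sel r) r (arb r (T⇒∈ a)) (proj₁ (proj₁ (arb r (T⇒∈ a))) v (T⇒∈ b))) =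
        i , crossing⇒crossᵇ wall⊆R r∉wall i (reached-root reach) s∉ t∈ , owner⁻ r _ i-sel

    cross-split : ∀ XO XI → cnt (crossᵇ XO XI) ≡ d⁻ H XO XI + cnt (λ e → (hv e ∈ᵇ XI) ∧ not (hu e ∈ᵇ XI))
    cross-split XO XI = trans (cnt-↑ na (crossᵇ XO XI)) (cong₂ _+_
      (cnt-cong λ a → cong [ _ , _ ] (splitAt-↑ˡ na a nh))
      (cnt-cong λ e → cong [ (λ a → entersBᵇ H a XO XI) , _ ] (splitAt-↑ʳ na nh e)))

    necessity : Condition H R M
    necessity ℓ XO XI XI⊆XO XI-ne XI⊆V XI-disj wall⊆R _ = begin
      Σ[ (λ i → rank R ∸ rank (XO i ─ XI i)) ]         ≤⟨ Σ-mono (λ i → demand≤cross (XO i) (XI i) (XI-ne i) (XI⊆V i) (wall⊆R i)) ⟩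
      Σ[ (λ i → cnt (crossᵇ (XO i) (XI i))) ]          ≤⟨ Σ-mono (λ i → ≤-reflexive (cross-split (XO i) (XI i))) ⟩
      Σ[ (λ i → d⁻ H (XO i) (XI i) + cnt (headed i)) ] ≡⟨ Σ-+ (λ i → d⁻ H (XO i) (XI i)) (λ i → cnt (headed i)) ⟨
      Σ[ (λ i → d⁻ H (XO i) (XI i)) ] + Σ[ (λ i → cnt (headed i)) ]
        ≤⟨ +-monoʳ-≤ Σ[ (λ i → d⁻ H (XO i) (XI i)) ] (Σ-cnt-disjoint headed (λ e → anyᵇ λ i → entersEᵇ H e (XI i)) enters unique) ⟩
      Σ[ (λ i → d⁻ H (XO i) (XI i)) ] + eE H XI        ≡⟨ +-comm _ (eE H XI) ⟩
      eE H XI + Σ[ (λ i → d⁻ H (XO i) (XI i)) ]        ∎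
      where
      open ≤-Reasoning
      headed : Fin ℓ → Fin nh → Bool
      headed i e = (hv e ∈ᵇ XI i) ∧ not (hu e ∈ᵇ XI i)
      headed⁻ : ∀ i e → T (headed i e) → hv e ∈ XI i × hu e ∉ XI i
      headed⁻ i e h with a , b ← T-∧⁻ {hv e ∈ᵇ XI i} h = T⇒∈ a , λ hu∈ → T-not⁻ b (∈⇒T hu∈)
        where
        T-not⁻ : ∀ {b} → T (not b) → ¬ T b
        T-not⁻ {true} ()
        T-not⁻ {false} _ ()
      enters : ∀ i e → T (headed i e) → T (anyᵇ λ i → entersEᵇ H e (XI i))
      enters i e h with hv∈XI , hu∉XI ← headed⁻ i e h = T-any⁺ i (entersE⁺ (hv∈ e) hv∈XI (hu∈ e) hu∉XI)
      -- `hv e` lies in at most one of the disjoint sets.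
      unique : ∀ e i j → T (headed i e) → T (headed j e) → i ≡ j
      unique e i j hi hj = decidable-stable (i ≟ j) λ i≢j →
        XI-disj i j i≢j (hv e , x∈p∩q⁺ (proj₁ (headed⁻ i e hi) , proj₁ (headed⁻ j e hj)))

-- Sufficiency of the condition.

module Sufficiency {n : ℕ} (H : MixedHypergraph n) (R : Subset n) (roots : ∀ r → r ∈ R → IsRoot H r)
                   (M : Matroid R) (condition : Condition H R M) where
  open MixedHypergraph H
  open Rooted H R roots
  open Matroid M
  open MatroidRank M
  open Orientation (∁ R)
  open Orient (∁ R) (rank R + nh)

  module Dyper = Entering {m = na} (λ _ → true) (λ a → tail a ∩ ∁ R) head

  rootsInto : Fin n → Subset n
  rootsInto v = tabulate λ r → (r ∈ᵇ R) ∧ anyᵇ λ a → (head a == v) ∧ (r ∈ᵇ tail a)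

  rootsInto⁻ : ∀ {r v} → r ∈ rootsInto v → r ∈ R × ∃ λ a → head a ≡ v × r ∈ tail a
  rootsInto⁻ {r} {v} r∈ with x , y ← T-∧⁻ {r ∈ᵇ R} (∈tabulate⁻ r∈) with a , t ← T-any⁻ y with e , b ← T-∧⁻ {head a == v} t =
    T⇒∈ x , a , T-==⁻ e , T⇒∈ b

  hedge-nonempty : ∀ e → Nonempty (hedge e)
  hedge-nonempty e = decidable-stable (nonempty? (hedge e)) λ empty →
    n≮0 (<-≤-trans (<-≤-trans z<s (hedge-size e)) (≤-reflexive (trans (cong ∣_∣ (Empty-unique {p = hedge e} empty)) (∣⊥∣≡0 n))))

  outsideᵇ : Subset n → Fin nh → Bool
  outsideᵇ X e = nonemptyᵇ (hedge e ─ X)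

  outside⁺ : ∀ {X e v} → v ∈ hedge e → v ∉ X → T (outsideᵇ X e)
  outside⁺ v∈e v∉X = T-nonempty⁺ (_ , x∈p∧x∉q⇒x∈p─q v∈e v∉X)

  outside⁻ : ∀ {X e} → T (outsideᵇ X e) → ∃ λ v → v ∈ hedge e × v ∉ X
  outside⁻ {X} {e} t with v , v∈ ← T-nonempty⁻ {X = hedge e ─ X} t = v , ∈─⁻ v∈

  -- A head hv e ∈ X makes e enter X unless hedge e ⊆ X. Adding nh to the demand and the number of hyperedges
  -- not inside X to the supply turns the requirement into one that is modular in the heads.
  supply : Subset n → ℕ
  supply X = Dyper.d X + f rootsInto X + cnt (outsideᵇ X)

  outside-submod : ∀ X Y → cnt (outsideᵇ (X ∪ Y)) + cnt (outsideᵇ (X ∩ Y)) ≤ cnt (outsideᵇ X) + cnt (outsideᵇ Y)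
  outside-submod X Y = cnt-+≤+ {p = outsideᵇ (X ∪ Y)} {outsideᵇ (X ∩ Y)} {outsideᵇ X} {outsideᵇ Y} λ e →
    bit-submod (inj₁ ∘ proj₁ ∘ union e) (inter e) (λ t _ → union e t)
    where
    union : ∀ e → T (outsideᵇ (X ∪ Y) e) → T (outsideᵇ X e) × T (outsideᵇ Y e)
    union e t with v , v∈ , v∉ ← outside⁻ {X ∪ Y} {e} t = outside⁺ v∈ (v∉ ∘ p⊆p∪q Y) , outside⁺ v∈ (v∉ ∘ q⊆p∪q X Y)
    inter : ∀ e → T (outsideᵇ (X ∩ Y) e) → T (outsideᵇ X e) ⊎ T (outsideᵇ Y e)
    inter e t with v , v∈ , v∉ ← outside⁻ {X ∩ Y} {e} t with v ∈? X
    ... | no v∉X = inj₁ (outside⁺ v∈ v∉X)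
    ... | yes v∈X = inj₂ (outside⁺ v∈ λ v∈Y → v∉ (x∈p∩q⁺ (v∈X , v∈Y)))

  supply-submod : IntersectingSubmodular supply
  supply-submod X Y _ _ _ = begin
    supply (X ∪ Y) + supply (X ∩ Y)
      ≡⟨ arith (Dyper.d (X ∪ Y)) _ _ (Dyper.d (X ∩ Y)) _ _ ⟩
    (Dyper.d (X ∪ Y) + Dyper.d (X ∩ Y)) + (f rootsInto (X ∪ Y) + f rootsInto (X ∩ Y)) + (cnt (outsideᵇ (X ∪ Y)) + cnt (outsideᵇ (X ∩ Y)))
      ≤⟨ +-mono-≤ (+-mono-≤ (Dyper.d-submod X Y) (f-submod rootsInto X Y)) (outside-submod X Y) ⟩
    (Dyper.d X + Dyper.d Y) + (f rootsInto X + f rootsInto Y) + (cnt (outsideᵇ X) + cnt (outsideᵇ Y))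
      ≡⟨ arith (Dyper.d X) _ _ (Dyper.d Y) _ _ ⟨
    supply X + supply Y ∎
    where
    open ≤-Reasoning
    arith : ∀ a b c a′ b′ c′ → (a + b + c) + (a′ + b′ + c′) ≡ (a + a′) + (b + b′) + (c + c′)
    arith = solve-∀

  wall : Subset n → Subset n
  wall X = N⁻ H X ∩ R

  N⁻-⁺ : ∀ {X a v} → head a ∈ X → v ∈ tail a → v ∉ X → v ∈ N⁻ H X
  N⁻-⁺ {X} {a} h∈ v∈ v∉ = ∈tabulate⁺ (T-any⁺ a (T-∧⁺ (T-∧⁺ (∈⇒T h∈) (T-nonempty⁺ (_ , x∈p∧x∉q⇒x∈p─q v∈ v∉)))
    (T-∧⁺ (∈⇒T v∈) (T-not⁺ (v∉ ∘ T⇒∈)))))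

  N⁻-⁻ : ∀ {X v} → v ∈ N⁻ H X → ∃ λ a → head a ∈ X × v ∈ tail a
  N⁻-⁻ {X} {v} v∈ with a , t ← T-any⁻ (∈tabulate⁻ v∈) with x , y ← T-∧⁻ {entersAᵇ H a X} t =
    a , T⇒∈ (proj₁ (T-∧⁻ {head a ∈ᵇ X} x)) , T⇒∈ (proj₁ (T-∧⁻ {v ∈ᵇ tail a} y))

  wall-─ : ∀ X → X ⊆ ∁ R → (X ∪ wall X) ─ X ≡ wall X
  wall-─ X X⊆V = ⊆-antisym to λ v∈ → x∈p∧x∉q⇒x∈p─q (q⊆p∪q X (wall X) v∈) λ v∈X → x∈∁p⇒x∉p (X⊆V v∈X) (p∩q⊆q (N⁻ H X) R v∈)
    where
    to : (X ∪ wall X) ─ X ⊆ wall X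
    to v∈ with v∈XO , v∉X ← ∈─⁻ {X = X ∪ wall X} {X} v∈ = [ ⊥-elim ∘ v∉X , id ] (x∈p∪q⁻ X (wall X) v∈XO)

  rank-wall≤ : ∀ X → rank (wall X) ≤ f rootsInto X
  rank-wall≤ X = ≤-trans (≤-reflexive (sym (ρ≡rank (wall X) (p∩q⊆q (N⁻ H X) R)))) (ρ-mono (wall X) _ sub)
    where
    sub : wall X ⊆ image rootsInto X
    sub r∈ with r∈N , r∈R ← x∈p∩q⁻ (N⁻ H X) R r∈ with a , h∈ , r∈a ← N⁻-⁻ {X} r∈N =
      image⁺ rootsInto h∈ (∈tabulate⁺ (T-∧⁺ (∈⇒T r∈R) (T-any⁺ a (T-∧⁺ (T-==⁺ {u = head a} refl) (∈⇒T r∈a)))))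

  -- A tail vertex outside `X ∪ wall X` is not a root, as a root in the tail of a dyperedge entering
  -- `X` belongs to the wall when it lies outside `X`.
  d⁻≤ : ∀ X → d⁻ H (X ∪ wall X) X ≤ Dyper.d X
  d⁻≤ X = cnt-mono enters
    where
    enters : ∀ a → T (entersBᵇ H a (X ∪ wall X) X) → T (Dyper.entᵇ a X)
    enters a t with x , y ← T-∧⁻ {head a ∈ᵇ X} t with w , w∈ ← T-nonempty⁻ {X = tail a ─ (X ∪ wall X)} y
      with w∈a , w∉ ← ∈─⁻ {X = tail a} w∈ =
      Dyper.ent⁺ tt (T⇒∈ x) (x∈p∩q⁺ (w∈a , x∉p⇒x∈∁p λ w∈R → w∉ (q⊆p∪q X (wall X) (x∈p∩q⁺ (N⁻-⁺ (T⇒∈ x) w∈a w∉X , w∈R))))) w∉X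
      where
      w∉X = w∉ ∘ p⊆p∪q (wall X)

  -- A hyperedge that lies inside one member enters none and lies inside no other; entering or
  -- inside, it meets `Z`. The entering hyperedges form class `zero` of `q`.
  hedge-cover : ∀ {c Z} (X : Fin c → Subset n) → (∀ i → X i ⊆ Z) → (∀ i j → i ≢ j → Empty (X i ∩ X j)) →
                eE H X + Σ[ (λ i → cnt (λ e → not (outsideᵇ (X i) e))) ] ≤ meets hedge Z
  hedge-cover {c} {Z} X X⊆Z disj = Σ-cnt-disjoint q (λ e → nonemptyᵇ (hedge e ∩ Z)) q⇒ unique
    where
    q : Fin (suc c) → Fin nh → Bool
    q zero    e = anyᵇ λ i → entersEᵇ H e (X i)
    q (suc i) e = not (outsideᵇ (X i) e)
    inside : ∀ i e → T (q (suc i) e) → hedge e ⊆ X i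
    inside i e t {v} v∈ = decidable-stable (v ∈? X i) λ v∉ → contradict (outside⁺ v∈ v∉) t
      where
      contradict : ∀ {b} → T b → ¬ T (not b)
      contradict {true} _ ()
    q⇒ : ∀ i e → T (q i e) → T (nonemptyᵇ (hedge e ∩ Z))
    q⇒ zero e t with i , ti ← T-any⁻ {p = λ i → entersEᵇ H e (X i)} t with (u , u∈e , u∈X) , _ ← entersE⁻ {e} {X i} ti =
      T-nonempty⁺ (u , x∈p∩q⁺ (u∈e , X⊆Z i u∈X))
    q⇒ (suc i) e t = T-nonempty⁺ (_ , x∈p∩q⁺ (v∈ , X⊆Z i (inside i e t v∈)))
      where v∈ = proj₂ (hedge-nonempty e)
    same : ∀ i j {v} → v ∈ X i → v ∈ X j → i ≡ j
    same i j v∈i v∈j = decidable-stable (i ≟ j) λ i≢j → disj i j i≢j (_ , x∈p∩q⁺ (v∈i , v∈j))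
    not-both : ∀ e i → T (q zero e) → ¬ T (q (suc i) e)
    not-both e i t t′ with j , tj ← T-any⁻ {p = λ i → entersEᵇ H e (X i)} t
      with (u , u∈e , u∈X) , (v , v∈e , v∉X) ← entersE⁻ {e} {X j} tj
      with refl ← same i j (inside i e t′ u∈e) u∈X = v∉X (inside i e t′ v∈e)
    unique : ∀ e i j → T (q i e) → T (q j e) → i ≡ j
    unique e zero    zero    _ _  = refl
    unique e zero    (suc j) t t′ = ⊥-elim (not-both e j t t′)
    unique e (suc i) zero    t t′ = ⊥-elim (not-both e i t′ t)
    unique e (suc i) (suc j) t t′ with v , v∈ ← hedge-nonempty e = cong suc (same i j (inside i e t v∈) (inside j e t′ v∈))

  -- The condition is applied to the members with their walls. For each member, every hyperedge is
  -- inside it or not, which pays the extra `nh`; the inside ones then join the entering ones under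
  -- `hedge-cover`.
  cover-bound : CoverBound hedge supply
  cover-bound {Z} {c} C with X , X-part , X⊆Z , X-disj , refl ← family C = begin
    (rank R + nh) * c                                                  ≡⟨ *-comm (rank R + nh) c ⟩
    c * (rank R + nh)                                                  ≡⟨ Σ-const c (rank R + nh) ⟨
    Σ[ (λ (_ : Fin c) → rank R + nh) ]                                 ≤⟨ Σ-mono (λ i → +-mono-≤ (rank≤ i) (nh≤ i)) ⟩
    Σ[ (λ i → demand i + fX i + (out i + inn i)) ]                     ≡⟨ split ⟩
    Σ[ demand ] + Σ[ fX ] + (Σ[ out ] + Σ[ inn ])                      ≤⟨ +-monoˡ-≤ _ (+-monoˡ-≤ Σ[ fX ] demand≤) ⟩
    eE H X + Σ[ dX ] + Σ[ fX ] + (Σ[ out ] + Σ[ inn ])                 ≡⟨ arith (eE H X) Σ[ dX ] Σ[ fX ] Σ[ out ] Σ[ inn ] ⟩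
    eE H X + Σ[ inn ] + (Σ[ dX ] + Σ[ fX ] + Σ[ out ])                 ≤⟨ +-monoˡ-≤ _ (hedge-cover X X⊆Z X-disj) ⟩
    meets hedge Z + (Σ[ dX ] + Σ[ fX ] + Σ[ out ])                     ≡⟨ cong (meets hedge Z +_) (trans (cong (_+ Σ[ out ]) (Σ-+ dX fX)) (Σ-+ _ out)) ⟩
    meets hedge Z + Σ[ supply ∘ X ]                                    ∎
    where
    open ≤-Reasoning
    demand dX fX out inn : Fin c → ℕ
    demand i = rank R ∸ rank ((X i ∪ wall (X i)) ─ X i)
    dX i = Dyper.d (X i)
    fX i = f rootsInto (X i)
    out i = cnt (outsideᵇ (X i))
    inn i = cnt (λ e → not (outsideᵇ (X i) e))
    X⊆V : ∀ i → X i ⊆ ∁ R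
    X⊆V i = proj₂ (X-part i)
    rank≤ : ∀ i → rank R ≤ demand i + fX i
    rank≤ i = ≤-trans (m≤n+m∸n (rank R) (rank ((X i ∪ wall (X i)) ─ X i)))
      (≤-trans (≤-reflexive (+-comm _ (demand i))) (+-monoʳ-≤ (demand i)
        (≤-trans (≤-reflexive (cong rank (wall-─ (X i) (X⊆V i)))) (rank-wall≤ (X i)))))
    nh≤ : ∀ i → nh ≤ out i + inn i
    nh≤ i = ≤-trans (≤-reflexive (sym (trans (cnt≡Σ {nh} (λ _ → true)) (trans (Σ-const nh 1) (*-identityʳ nh)))))
      (cnt-≤+ {p = λ _ → true} {outsideᵇ (X i)} {λ e → not (outsideᵇ (X i) e)} λ e → either (outsideᵇ (X i) e))
      where
      either : ∀ b → 1 ≤ bit b + bit (not b)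
      either true  = ≤-refl
      either false = ≤-refl
    demand≤ : Σ[ demand ] ≤ eE H X + Σ[ dX ]
    demand≤ = ≤-trans (condition c (λ i → X i ∪ wall (X i)) X (λ i → p⊆p∪q (wall (X i))) (proj₁ ∘ X-part) X⊆V X-disj
        (λ i r∈ → p∩q⊆q (N⁻ H (X i)) R (subst (_ ∈_) (wall-─ (X i) (X⊆V i)) r∈)) (λ i → wall-─ (X i) (X⊆V i)))
      (+-monoʳ-≤ (eE H X) (Σ-mono λ i → d⁻≤ (X i)))
    split : Σ[ (λ i → demand i + fX i + (out i + inn i)) ] ≡ Σ[ demand ] + Σ[ fX ] + (Σ[ out ] + Σ[ inn ])
    split = sym (trans (cong₂ _+_ (Σ-+ demand fX) (Σ-+ out inn)) (Σ-+ (λ i → demand i + fX i) (λ i → out i + inn i)))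
    arith : ∀ a b c d e → a + b + c + (d + e) ≡ a + e + (b + c + d)
    arith = solve-∀

  abstract
    oriented : ∃ λ (hv : Fin nh → Fin n) → (∀ e → hv e ∈ hedge e) × (∀ X → IsPart X → rank R + nh ≤ supply X + cnt (λ e → hv e ∈ᵇ X))
    oriented = heads nh hedge supply (orient nh hedge hedge-nonempty supply supply-submod cover-bound)

  hv : Fin nh → Fin n
  hv = proj₁ oriented

  hv∈ : ∀ e → hv e ∈ hedge e
  hv∈ = proj₁ (proj₂ oriented)

  tl : Fin (na + nh) → Subset n
  tl i = [ tail , (λ e → hedge e - hv e) ] (splitAt na i)

  hd : Fin (na + nh) → Fin n
  hd i = [ head , hv ] (splitAt na i)

  hd∉R : ∀ i → hd i ∉ R
  hd∉R i with splitAt na i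
  ... | inj₁ a = head∉R a
  ... | inj₂ e = λ hv∈R → hedge∌root e (hv e) hv∈R (hv∈ e)

  tl-nonempty : ∀ i → Nonempty (tl i)
  tl-nonempty i with splitAt na i
  ... | inj₁ a = tail-nonempty a
  ... | inj₂ e with w , w∈ , w≢ ← hedge-other e (hv e) = w , x∈p∧x≢y⇒x∈p-y w∈ w≢

  tl-root : ∀ i r → r ∈ R → r ∈ tl i → tl i ≡ ⁅ r ⁆
  tl-root i r r∈R r∈ with splitAt na i
  ... | inj₁ a = tail-root a r r∈R r∈
  ... | inj₂ e = ⊥-elim (hedge∌root e r r∈R (p─q⊆p (hedge e) ⁅ hv e ⁆ r∈))

  open Growing M tl hd
  open Packs hd∉R

  abstract
    phase₁ : ∃ λ S → (∀ i r → r ∈ R → r ∈ tl i → InSpan r (State.P S (hd i))) × (∀ i → Nonempty (inner i) → T (State.free S i))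
    phase₁ = root-phase tl-root tl-nonempty

  S₁ : State
  S₁ = proj₁ phase₁

  P₁ : Fin n → Subset n
  P₁ = State.P S₁

  headedᵇ : Subset n → Fin nh → Bool
  headedᵇ X e = (hv e ∈ᵇ X) ∧ outsideᵇ X e

  -- For each hyperedge, the indicators of a vertex outside `X` and of a head in `X` exceed that of
  -- entering `X` by at most one in total; the excess sums to at most `nh` and cancels.
  directed-cut : ∀ X → IsPart X → rank R ≤ Dyper.d X + f rootsInto X + cnt (headedᵇ X)
  directed-cut X X-part = +-cancelʳ-≤ nh _ _ (begin
    rank R + nh                                                ≤⟨ proj₂ (proj₂ oriented) X X-part ⟩
    a + cnt (outsideᵇ X) + cnt (λ e → hv e ∈ᵇ X)               ≡⟨ +-assoc a _ _ ⟩
    a + (cnt (outsideᵇ X) + cnt (λ e → hv e ∈ᵇ X))             ≤⟨ +-monoʳ-≤ a (cnt-+≤+ {p = outsideᵇ X} {λ e → hv e ∈ᵇ X} {headedᵇ X} {λ _ → true} λ e →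
                                                                    pointwise (outsideᵇ X e) (hv e ∈ᵇ X)) ⟩
    a + (cnt (headedᵇ X) + cnt (λ (_ : Fin nh) → true))        ≤⟨ +-monoʳ-≤ a (+-monoʳ-≤ (cnt (headedᵇ X)) (∣p∣≤n (tabulate λ (_ : Fin nh) → true))) ⟩
    a + (cnt (headedᵇ X) + nh)                                 ≡⟨ +-assoc a _ _ ⟨
    a + cnt (headedᵇ X) + nh                                   ∎)
    where
    open ≤-Reasoning
    a = Dyper.d X + f rootsInto X
    pointwise : ∀ b c → bit b + bit c ≤ bit (c ∧ b) + 1
    pointwise true  true  = ≤-refl
    pointwise true  false = ≤-refl
    pointwise false true  = ≤-refl
    pointwise false false = z≤n

  private
    tl-ˡ : ∀ a → tl (a ↑ˡ nh) ≡ tail a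
    tl-ˡ a = cong [ tail , (λ e → hedge e - hv e) ] (splitAt-↑ˡ na a nh)
    tl-ʳ : ∀ e → tl (na ↑ʳ e) ≡ hedge e - hv e
    tl-ʳ e = cong [ tail , (λ e → hedge e - hv e) ] (splitAt-↑ʳ na nh e)
    hd-ˡ : ∀ a → hd (a ↑ˡ nh) ≡ head a
    hd-ˡ a = cong [ head , hv ] (splitAt-↑ˡ na a nh)
    hd-ʳ : ∀ e → hd (na ↑ʳ e) ≡ hv e
    hd-ʳ e = cong [ head , hv ] (splitAt-↑ʳ na nh e)

  -- Edges with a tail vertex outside `R` are still free and count as before, and the roots with
  -- dyperedges into `X` are spanned by those already present in `X`.
  S₁-covered : Covered S₁
  S₁-covered X X-part = begin
    rank R                                                  ≤⟨ directed-cut X X-part ⟩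
    Dyper.d X + f rootsInto X + cnt (headedᵇ X)             ≡⟨ arith (Dyper.d X) _ _ ⟩
    Dyper.d X + cnt (headedᵇ X) + f rootsInto X             ≤⟨ +-mono-≤ (+-mono-≤ (cnt-mono dyper) (cnt-mono hyper)) roots≤ ⟩
    cnt (λ a → Ent.entᵇ S₁ (a ↑ˡ nh) X) + cnt (λ e → Ent.entᵇ S₁ (na ↑ʳ e) X) + f P₁ X
      ≡⟨ cong (_+ f P₁ X) (cnt-↑ na (λ i → Ent.entᵇ S₁ i X)) ⟨
    Ent.d S₁ X + f P₁ X                                     ∎
    where
    open ≤-Reasoning
    arith : ∀ a b c → a + b + c ≡ a + c + b
    arith = solve-∀
    entering : ∀ i {w} → hd i ∈ X → w ∈ inner i → w ∉ X → T (Ent.entᵇ S₁ i X)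
    entering i h∈ w∈ w∉ = Ent.ent⁺ S₁ (proj₂ (proj₂ phase₁) i (_ , w∈)) h∈ w∈ w∉
    dyper : ∀ a → T (Dyper.entᵇ a X) → T (Ent.entᵇ S₁ (a ↑ˡ nh) X)
    dyper a t with _ , h∈ , w , w∈ , w∉ ← Dyper.ent⁻ {a} {X} t =
      entering (a ↑ˡ nh) (subst (_∈ X) (sym (hd-ˡ a)) h∈) (subst (λ Y → w ∈ Y ∩ ∁ R) (sym (tl-ˡ a)) w∈) w∉
    hyper : ∀ e → T (headedᵇ X e) → T (Ent.entᵇ S₁ (na ↑ʳ e) X)
    hyper e t with x , y ← T-∧⁻ {hv e ∈ᵇ X} t with w , w∈ , w∉ ← outside⁻ {X} {e} y =
      entering (na ↑ʳ e) (subst (_∈ X) (sym (hd-ʳ e)) (T⇒∈ x)) (subst (λ Y → w ∈ Y ∩ ∁ R) (sym (tl-ʳ e))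
        (x∈p∩q⁺ (x∈p∧x≢y⇒x∈p-y w∈ (λ { refl → w∉ (T⇒∈ x) }) , x∉p⇒x∈∁p λ w∈R → hedge∌root e w w∈R w∈))) w∉
    roots≤ : f rootsInto X ≤ f P₁ X
    roots≤ = ≤-trans (ρ-mono (image rootsInto X) (image P₁ X ∪ image rootsInto X) (q⊆p∪q (image P₁ X) _))
      (span-rank (image P₁ X) (image rootsInto X) spanned)
      where
      spanned : ∀ r → r ∈ image rootsInto X → InSpan r (image P₁ X)
      spanned r r∈ with v , v∈X , r∈v ← image⁻ rootsInto r∈ with r∈R , a , refl , r∈a ← rootsInto⁻ r∈v =
        inSpan-mono r (P₁ (hd (a ↑ˡ nh))) (image P₁ X) (image⁺ P₁ (subst (_∈ X) (sym (hd-ˡ a)) v∈X))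
          (proj₁ (proj₂ phase₁) (a ↑ˡ nh) r r∈R (subst (r ∈_) (sym (tl-ˡ a)) r∈a))

  abstract
    final : ∃ λ S → ∀ v → v ∉ R → rank R ≤ ρ (State.P S v)
    final = complete S₁ S₁-covered

  S₂ : State
  S₂ = proj₁ final

  open State S₂

  trimming : Trimming H R M
  trimming = record
    { ownA = λ a → own (a ↑ˡ nh)
    ; ownE = λ e → own (na ↑ʳ e)
    ; ownA-root = λ a → own∈R (a ↑ˡ nh)
    ; ownE-root = λ e → own∈R (na ↑ʳ e)
    ; tl = λ a → source (a ↑ˡ nh)
    ; tl∈ = λ a → subst (source (a ↑ˡ nh) ∈_) (tl-ˡ a) (source∈ (a ↑ˡ nh))
    ; hu = λ e → source (na ↑ʳ e)
    ; hv = hv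
    ; hu∈ = λ e → p─q⊆p (hedge e) ⁅ hv e ⁆ (source∈ʳ e)
    ; hv∈ = hv∈
    ; hu≢hv = λ e eq → proj₂ (∈─⁻ {X = hedge e} {⁅ hv e ⁆} (source∈ʳ e)) (subst (_∈ ⁅ hv e ⁆) (sym eq) (x∈⁅x⁆ (hv e))) }
    where
    source∈ʳ : ∀ e → source (na ↑ʳ e) ∈ hedge e - hv e
    source∈ʳ e = subst (source (na ↑ʳ e) ∈_) (tl-ʳ e) (source∈ (na ↑ʳ e))

  -- A `Trimming` keeps dyperedges and hyperedges apart and glues them with `splitAt`; this
  -- identifies the glued functions with those of the state.
  ∘splitAt : {A : Set} (g : Fin (na + nh) → A) (i : Fin (na + nh)) → g i ≡ [ (λ a → g (a ↑ˡ nh)) , (λ e → g (na ↑ʳ e)) ] (splitAt na i)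
  ∘splitAt g i with splitAt na i in eq
  ... | inj₁ a = cong g (sym (splitAt⁻¹-↑ˡ eq))
  ... | inj₂ e = cong g (sym (splitAt⁻¹-↑ʳ eq))

  selected≗ : ∀ r i → selected own r i ≡ selR H R M trimming r i
  selected≗ r i = trans (isOwn≗ (own i)) (cong (isOwn H R M trimming r) (∘splitAt own i))
    where
    isOwn≗ : ∀ o → ownedᵇ r o ≡ isOwn H R M trimming r o
    isOwn≗ (just _) = refl
    isOwn≗ nothing  = refl

  module Translate (r : Fin n) = Arborescence.Congruence {src = source} {src H R M trimming} {hd} {tgt H R M trimming} r
    (selected≗ r) (λ i _ → ∘splitAt source i , refl)

  packing : Packing H R M
  packing = record
    { trim = trimming
    ; arb = λ r r∈R → Translate.arborescence-cong r (arb r r∈R)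
    ; basis = λ v v∉R → subst (IsBasis M) (tabulate-cong λ r → cong (λ X → (r ∈ᵇ R) ∧ (v ∈ᵇ X)) (Translate.VS-cong r)) (P-basis v v∉R) }
    where
    -- Independence is the invariant of the state, and full rank then makes the size of `P v` equal
    -- to `rank R`.
    P-basis : ∀ v → v ∉ R → IsBasis M (P v)
    P-basis v v∉R = (P⊆R , trans (sym (ρ≡rank (P v) P⊆R)) (indep v v∉R)) ,
      trans (sym (indep v v∉R)) (≤-antisym (ρ≤rankR (P v)) (proj₂ final v v∉R))
      where
      P⊆R : P v ⊆ R
      P⊆R = proj₁ ∘ P⁻

theorem10 : ∀ {n : ℕ} (H : MixedHypergraph n) (R : Subset n) →
            (∀ r → r ∈ R → IsRoot H r) →
            (M : Matroid R) →
            Packing H R M ⇔ Condition H R M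
theorem10 H R roots M = mk⇔ (Rooted.Necessity.necessity H R roots M) (Sufficiency.packing H R roots M)
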